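{- Let $G,H$ be Polish groups, let $X$ be a Polish $G$-space, let $Y$ be a Polish $H$-space, and let $f\colon X\to Y$ be a $*$-reduction from $E^G_X$ to $E^H_Y$. Then there is a $G$-invariant dense $G_\delta$ subset $X_0$ of $X$ and an $H$-invariant non-meager Baire measurable subset $Y_0$ of $Y$ such that the induced map $[f]\colon [x]\mapsto [f(x)]$, restricted to $X_0/G$, is an isomorphism from the digraph $\mathcal{B}(X_0/G)$ to the digraph $\mathcal{B}(Y_0/H)$.
   Context: A Polish $G$-space is a Polish space $X$ with a continuous action $G\times X\to X$ of the Polish group $G$; $E^G_X$ is its orbit equivalence relation on $X$ and $[x]$ denotes the orbit of $x$. A set is Baire measurable if it has the Baire property; a map is Baire measurable if preimages of open sets have the Baire property. A map $f\colon X\to Y$ between Polish spaces is category preserving if $f^{ -1}(M)$ is meager in $X$ for every meager $M\subseteq Y$. A $*$-reduction from an equivalence relation $E$ on $X$ to an equivalence relation $F$ on $Y$ is a Baire measurable category preserving map $f\colon X\to Y$ such that $x\,E\,x'\iff f(x)\,F\,f(x')$ for all $x,x'\in X$. A sequence $(g_n)$ in a Polish group is right-Cauchy if it is Cauchy with respect to some (equivalently, any) compatible right-invariant metric. For points $x,x'$ of a Polish $G$-space $X$, $x$ right-embeds in $x'$ if there is a right-Cauchy sequence $(g_n)$ in $G$ such that $g_n x'$ converges to $x$; this depends only on the orbits of $x$ and $x'$. For a $G$-invariant $C\subseteq X$, the (right) Becker digraph $\mathcal{B}(C/G)$ has vertex set $C/G=\{[x]\mid x\in C\}$ and an arrow from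 $[x]$ to $[x']$ exactly when $x$ right-embeds in $x'$. -}

module Defs where

open import Algebra.Bundles using (Group)
import Algebra.Properties.Group as GroupProperties
open import Data.Maybe.Base using (Maybe; just)
open import Data.Nat.Base as ℕ using (ℕ)
open import Data.Product.Base using (Σ; ∃; _×_; _,_; proj₁; proj₂; uncurry)
open import Data.Product.Relation.Binary.Pointwise.NonDependent using (×-setoid)
open import Data.Rational.Base as ℚ using (ℚ; 0ℚ; 1ℚ)
import Data.Rational.Properties as ℚ
open import Data.Unit.Base using (tt)
open import Function.Base using (_∘_)
open import Function.Bundles using (Func; _⇔_; Equivalence)
open import Function.Metric.Structures using (IsGeneralMetric)
open import Function.Structures using (IsBijection)
open import Level using (Level; 0ℓ; suc)
open import Relation.Binary.Bundles using (Setoid)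
open import Relation.Binary.Core using (Rel)
open import Relation.Binary.Definitions using (_Respects_; _Respects₂_)
open import Relation.Binary.PropositionalEquality.Core as ≡ using (_≡_; subst; cong)
import Relation.Binary.Construct.On as On
import Relation.Binary.Reasoning.Setoid as SetoidReasoning
open import Relation.Binary.Structures using (IsEquivalence)
open import Relation.Nullary.Negation.Core using (¬_)
open import Relation.Unary

1ℓ : Level
1ℓ = suc 0ℓ

------------------------------------------------------------------------
-- Real numbers, as (lower) Dedekind cuts.  These are the usual reals in
-- the presence of excluded middle; no constructive content is intended.

record ℝ : Set₁ where
  field
    cut       : Pred ℚ 0ℓ
    inhabited : ∃ λ q → q ∈ cut
    bounded   : ∃ λ q → q ∉ cut
    downward  : ∀ {p q} → p ℚ.≤ q → q ∈ cut → p ∈ cut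
    no-max    : ∀ {p} → p ∈ cut → ∃ λ q → p ℚ.< q × q ∈ cut

open ℝ

infix 4 _≤ᴿ_ _≃ᴿ_ _<ᴿ_
infixl 6 _+ᴿ_

_≤ᴿ_ _≃ᴿ_ _<ᴿ_ : Rel ℝ 0ℓ
x ≤ᴿ y = cut x ⊆ cut y
x ≃ᴿ y = cut x ≐ cut y
x <ᴿ y = ∃ λ q → q ∉ cut x × q ∈ cut y

fromℚ : ℚ → ℝ
fromℚ q = record
  { cut       = λ p → p ℚ.< q
  ; inhabited = q ℚ.- 1ℚ , subst (q ℚ.- 1ℚ ℚ.<_) (ℚ.+-identityʳ q)
                  (ℚ.+-monoʳ-< q {ℚ.- 1ℚ} {0ℚ} (ℚ.negative⁻¹ (ℚ.- 1ℚ)))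
  ; bounded   = q , ℚ.<-irrefl ≡.refl
  ; downward  = ℚ.≤-<-trans
  ; no-max    = ℚ.<-dense
  }

0ᴿ : ℝ
0ᴿ = fromℚ 0ℚ

below-bound : ∀ x {p u} → u ∉ cut x → p ∈ cut x → p ℚ.< u
below-bound x u∉ p∈ = ℚ.≰⇒> (λ u≤p → u∉ (downward x u≤p p∈))

_+ᴿ_ : ℝ → ℝ → ℝ
x +ᴿ y = record
  { cut       = λ q → ∃ λ a → ∃ λ b → a ∈ cut x × b ∈ cut y × q ℚ.≤ a ℚ.+ b
  ; inhabited = let (a , a∈) = inhabited x ; (b , b∈) = inhabited y
                in a ℚ.+ b , a , b , a∈ , b∈ , ℚ.≤-refl
  ; bounded   = let (u , u∉) = bounded x ; (v , v∉) = bounded y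
                in u ℚ.+ v , λ (a , b , a∈ , b∈ , le) →
                     ℚ.<-irrefl ≡.refl (ℚ.≤-<-trans le
                       (ℚ.+-mono-< (below-bound x u∉ a∈) (below-bound y v∉ b∈)))
  ; downward  = λ p≤q (a , b , a∈ , b∈ , le) → a , b , a∈ , b∈ , ℚ.≤-trans p≤q le
  ; no-max    = λ (a , b , a∈ , b∈ , le) →
      let (a′ , a<a′ , a′∈) = no-max x a∈
      in a′ ℚ.+ b , ℚ.≤-<-trans le (ℚ.+-monoˡ-< b a<a′) , a′ , b , a′∈ , b∈ , ℚ.≤-refl
  }

≃ᴿ-<ᴿ-trans : ∀ x y z → x ≃ᴿ y → y <ᴿ z → x <ᴿ z
≃ᴿ-<ᴿ-trans x y z x≃y (q , q∉y , q∈z) = q , q∉y ∘ proj₁ x≃y , q∈z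

------------------------------------------------------------------------
-- Topological spaces

-- Unions over small index types suffice: a set containing an open
-- neighbourhood of each of its points x is the union of these, indexed
-- by the small type of such x.

record Topology (S : Setoid 0ℓ 0ℓ) : Set₂ where
  open Setoid S
  field
    Open        : Pred (Pred Carrier 0ℓ) 1ℓ
    Open-resp-≐ : ∀ {U V} → U ≐ V → Open U → Open V
    Open⇒resp-≈ : ∀ {U} → Open U → U Respects _≈_
    Open-U      : Open U
    Open-∩      : ∀ {U V} → Open U → Open V → Open (U ∩ V)
    Open-⋃      : ∀ {I : Set} (U : I → Pred Carrier 0ℓ) →
                  (∀ i → Open (U i)) → Open (⋃ I U)

record TopologicalSpace : Set₂ where
  field
    setoid   : Setoid 0ℓ 0ℓ
    topology : Topology setoid
  open Setoid setoid public
  open Topology topology public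

_×ₜ_ : TopologicalSpace → TopologicalSpace → TopologicalSpace
S ×ₜ T = record
  { setoid   = ×-setoid S.setoid T.setoid
  ; topology = record
    { Open = λ W → W Respects Setoid._≈_ (×-setoid S.setoid T.setoid) ×
        (∀ x y → (x , y) ∈ W → ∃ λ U → ∃ λ V →
          S.Open U × T.Open V × x ∈ U × y ∈ V × (U ⟨×⟩ V) ⊆ W)
    ; Open-resp-≐ = λ (W⊆ , ⊆W) (resp , nbhd) →
        (λ p → W⊆ ∘ resp p ∘ ⊆W) ,
        λ x y xy∈ → let (U , V , oU , oV , x∈ , y∈ , UV⊆) = nbhd x y (⊆W xy∈)
                    in U , V , oU , oV , x∈ , y∈ , W⊆ ∘ UV⊆
    ; Open⇒resp-≈ = proj₁
    ; Open-U = (λ _ _ → tt) ,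
        λ x y _ → U , U , S.Open-U , T.Open-U , tt , tt , λ _ → tt
    ; Open-∩ = λ (resp₁ , nbhd₁) (resp₂ , nbhd₂) →
        (λ p (w₁ , w₂) → resp₁ p w₁ , resp₂ p w₂) ,
        λ x y (w₁ , w₂) →
          let (U₁ , V₁ , oU₁ , oV₁ , x∈₁ , y∈₁ , ⊆₁) = nbhd₁ x y w₁
              (U₂ , V₂ , oU₂ , oV₂ , x∈₂ , y∈₂ , ⊆₂) = nbhd₂ x y w₂
          in U₁ ∩ U₂ , V₁ ∩ V₂ , S.Open-∩ oU₁ oU₂ , T.Open-∩ oV₁ oV₂ ,
             (x∈₁ , x∈₂) , (y∈₁ , y∈₂) ,
             λ ((u₁ , u₂) , (v₁ , v₂)) → ⊆₁ (u₁ , v₁) , ⊆₂ (u₂ , v₂)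
    ; Open-⋃ = λ W oW →
        (λ p (i , w) → i , proj₁ (oW i) p w) ,
        λ x y (i , w) →
          let (U , V , oU , oV , x∈ , y∈ , UV⊆) = proj₂ (oW i) x y w
          in U , V , oU , oV , x∈ , y∈ , λ uv → i , UV⊆ uv
    }
  }
  where
  module S = TopologicalSpace S
  module T = TopologicalSpace T

Continuous : (S T : TopologicalSpace) →
             (TopologicalSpace.Carrier S → TopologicalSpace.Carrier T) → Set₁
Continuous S T f = ∀ {U} → TopologicalSpace.Open T U → TopologicalSpace.Open S (f ⊢ U)

module _ (T : TopologicalSpace) where
  open TopologicalSpace T

  ConvergesTo : (ℕ → Carrier) → Carrier → Set₁
  ConvergesTo s x = ∀ U → Open U → x ∈ U → ∃ λ N → ∀ n → N ℕ.≤ n → s n ∈ U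

  interior : ∀ {ℓ} → Pred Carrier ℓ → Pred Carrier _
  interior A x = ∃ λ U → Open U × x ∈ U × U ⊆ A

  closure : ∀ {ℓ} → Pred Carrier ℓ → Pred Carrier _
  closure A x = ∀ U → Open U → x ∈ U → U ≬ A

  Dense : ∀ {ℓ} → Pred Carrier ℓ → Set _
  Dense A = Π[ closure A ]

  IsGδ : Pred Carrier 0ℓ → Set₁
  IsGδ A = ∃ λ (U : ℕ → Pred Carrier 0ℓ) → (∀ n → Open (U n)) × A ≐ ⋂ ℕ U

  NowhereDense : Pred Carrier 0ℓ → Set₁
  NowhereDense A = Empty (interior (closure A))

  Meager : Pred Carrier 0ℓ → Set₁
  Meager A = ∃ λ (F : ℕ → Pred Carrier 0ℓ) → (∀ n → NowhereDense (F n)) × A ≐ ⋃ ℕ F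

  BaireMeasurable : Pred Carrier 0ℓ → Set₁
  BaireMeasurable A = ∃ λ U → Open U × Meager ((A ∖ U) ∪ (U ∖ A))

------------------------------------------------------------------------
-- Metrics and Polish spaces

record Metric (S : Setoid 0ℓ 0ℓ) : Set₁ where
  open Setoid S
  field
    d               : Carrier → Carrier → ℝ
    isGeneralMetric : IsGeneralMetric _≈_ _≃ᴿ_ _≤ᴿ_ 0ᴿ _+ᴿ_ d
  open IsGeneralMetric isGeneralMetric public
    using (triangle; ≈⇒0; 0⇒≈) renaming (sym to d-sym; cong to d-cong)

  ball : Carrier → ℝ → Pred Carrier 0ℓ
  ball x ε y = d x y <ᴿ ε

  MetricOpen : Pred Carrier 0ℓ → Set₁
  MetricOpen U = ∀ {x} → x ∈ U → ∃ λ ε → 0ᴿ <ᴿ ε × ball x ε ⊆ U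

  Cauchy : (ℕ → Carrier) → Set₁
  Cauchy s = ∀ ε → 0ᴿ <ᴿ ε →
             ∃ λ N → ∀ m n → N ℕ.≤ m → N ℕ.≤ n → d (s m) (s n) <ᴿ ε

  ball-open : ∀ x ε → MetricOpen (ball x ε)
  ball-open x ε {y} (q , q∉ , q∈) =
    let (q′ , q<q′ , q′∈) = no-max ε q∈
        0<δ = subst (ℚ._< q′ ℚ.- q) (ℚ.+-inverseʳ q) (ℚ.+-monoˡ-< (ℚ.- q) q<q′)
    in fromℚ (q′ ℚ.- q) , (0ℚ , ℚ.<-irrefl ≡.refl , 0<δ) ,
       λ {z} (r , r∉ , r<δ) → q′ , (λ q′∈xz →
         let (a , b , a∈ , b∈ , q′≤a+b) = triangle x y z q′∈xz
             a<q = below-bound (d x y) q∉ a∈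
             b<δ = ℚ.<-trans (below-bound (d y z) r∉ b∈) r<δ
         in ℚ.<-irrefl ≡.refl (ℚ.≤-<-trans q′≤a+b
              (subst (a ℚ.+ b ℚ.<_) (q+[q′-q]≡q′ q q′) (ℚ.+-mono-< a<q b<δ)))) , q′∈
    where
    q+[q′-q]≡q′ : ∀ q q′ → q ℚ.+ (q′ ℚ.- q) ≡ q′
    q+[q′-q]≡q′ q q′ = ≡.trans (ℚ.+-comm q (q′ ℚ.- q))
      (≡.trans (ℚ.+-assoc q′ (ℚ.- q) q)
      (≡.trans (cong (q′ ℚ.+_) (ℚ.+-inverseˡ q)) (ℚ.+-identityʳ q′)))

module _ (T : TopologicalSpace) where
  open TopologicalSpace T

  Compatible : Metric setoid → Set₁
  Compatible ρ = ∀ {U} → Open U ⇔ Metric.MetricOpen ρ U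

  Complete : Metric setoid → Set₁
  Complete ρ = ∀ s → Metric.Cauchy ρ s → ∃ (ConvergesTo T s)

  -- Enumerating by Maybe keeps the empty space separable.
  Separable : Set₁
  Separable = ∃ λ (s : ℕ → Maybe Carrier) → Dense T (λ x → ∃ λ n → s n ≡ just x)

  record IsPolish : Set₁ where
    field
      separable  : Separable
      metric     : Metric setoid
      compatible : Compatible metric
      complete   : Complete metric

------------------------------------------------------------------------
-- Polish groups and Polish G-spaces

record PolishGroup : Set₂ where
  field
    group    : Group 0ℓ 0ℓ
    topology : Topology (Group.setoid group)
  open Group group public
  space : TopologicalSpace
  space = record { setoid = setoid ; topology = topology }
  field
    isPolish      : IsPolish space
    ∙-continuous  : Continuous (space ×ₜ space) space (uncurry _∙_)
    ⁻¹-continuous : Continuous space space _⁻¹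

  RightInvariant : Metric setoid → Set
  RightInvariant ρ = ∀ g h k → d (g ∙ k) (h ∙ k) ≃ᴿ d g h
    where open Metric ρ

  RightCauchy : (ℕ → Carrier) → Set₁
  RightCauchy s = ∃ λ ρ → Compatible space ρ × RightInvariant ρ × Metric.Cauchy ρ s

record PolishGSpace (G : PolishGroup) : Set₂ where
  infixr 8 _·_
  private module G = PolishGroup G
  field
    space    : TopologicalSpace
    isPolish : IsPolish space
  open TopologicalSpace space public
  field
    _·_          : G.Carrier → Carrier → Carrier
    ·-cong       : ∀ {g h x y} → g G.≈ h → x ≈ y → g · x ≈ h · y
    ·-identity   : ∀ x → G.ε · x ≈ x
    ·-assoc      : ∀ g h x → (g G.∙ h) · x ≈ g · h · x
    ·-continuous : Continuous (G.space ×ₜ space) space (uncurry _·_)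

  OrbitEq : Rel Carrier 0ℓ
  OrbitEq x y = ∃ λ g → g · x ≈ y

  OrbitEq-isEquivalence : IsEquivalence OrbitEq
  OrbitEq-isEquivalence = record
    { refl  = λ {x} → G.ε , ·-identity x
    ; sym   = λ {x} (g , gx≈y) → g G.⁻¹ ,
        trans (·-cong G.refl (sym gx≈y))
        (trans (sym (·-assoc (g G.⁻¹) g x))
        (trans (·-cong (G.inverseˡ g) refl) (·-identity x)))
    ; trans = λ {x} (g , gx≈y) (h , hy≈z) → h G.∙ g ,
        trans (·-assoc h g x) (trans (·-cong G.refl gx≈y) hy≈z)
    }

  orbits : Setoid 0ℓ 0ℓ
  orbits = record { isEquivalence = OrbitEq-isEquivalence }

  Invariant : Pred Carrier 0ℓ → Set
  Invariant C = C Respects OrbitEq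

  RightEmbeds : Rel Carrier 1ℓ
  RightEmbeds x x′ = ∃ λ (s : ℕ → G.Carrier) →
    G.RightCauchy s × ConvergesTo space (λ n → s n · x′) x

------------------------------------------------------------------------
-- Right embeddability depends only on the orbits

module _ (G : PolishGroup) where
  open PolishGroup G
  open GroupProperties group using (⁻¹-anti-homo-∙)

  RightCauchy-translate : ∀ k h {s} → RightCauchy s → RightCauchy (λ n → k ∙ s n ∙ h)
  RightCauchy-translate k h {s} (ρ , compat , inv , cauchy) =
    ρ , (λ {U} → compat {U}) , inv , λ ε₀ 0<ε₀ →
      let
        B = ball ε ε₀
        oB = Equivalence.from (compat {B}) (ball-open ε ε₀)
        ε∈B = Topology.Open⇒resp-≈ topology oB
                (sym (trans (∙-congʳ (identityʳ k)) (inverseʳ k)))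
                (≃ᴿ-<ᴿ-trans (d ε ε) 0ᴿ ε₀ (≈⇒0 refl) 0<ε₀)
        (V , _ , oV , _ , kε∈V , k⁻¹∈ , ⊆B) = proj₂ (∙-continuous oB) (k ∙ ε) (k ⁻¹) ε∈B
        (_ , W , _ , oW , k∈ , ε∈W , ⊆V) = proj₂ (∙-continuous oV) k ε kε∈V
        (δ , 0<δ , ball⊆W) = Equivalence.to (compat {W}) oW ε∈W
        (N , close) = cauchy δ 0<δ
      in N , λ m n N≤m N≤n →
        let
          g = s n ∙ s m ⁻¹
          c = k ∙ g ∙ k ⁻¹
          close′ : g ∈ ball ε δ
          close′ = ≃ᴿ-<ᴿ-trans (d ε g) (d (s m ∙ s m ⁻¹) g) δ
                     (d-cong (sym (inverseʳ (s m))) refl)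
                   (≃ᴿ-<ᴿ-trans (d (s m ∙ s m ⁻¹) g) (d (s m) (s n)) δ
                     (inv (s m) (s n) (s m ⁻¹)) (close m n N≤m N≤n))
          c∈B : c ∈ B
          c∈B = ⊆B {k ∙ g , k ⁻¹} (⊆V {k , g} (k∈ , ball⊆W close′) , k⁻¹∈)
          y = k ∙ s n ∙ h
          z = k ∙ s m ∙ h
        in ≃ᴿ-<ᴿ-trans (d z y) (d (ε ∙ z) (c ∙ z)) ε₀
             (d-cong (sym (identityˡ z)) (sym (cancel (s n) (s m))))
           (≃ᴿ-<ᴿ-trans (d (ε ∙ z) (c ∙ z)) (d ε c) ε₀ (inv ε c z) c∈B)
    where
    open Metric ρ
    cancel : ∀ a b → k ∙ (a ∙ b ⁻¹) ∙ k ⁻¹ ∙ (k ∙ b ∙ h) ≈ k ∙ a ∙ h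
    cancel a b = begin
      k ∙ (a ∙ b ⁻¹) ∙ k ⁻¹ ∙ (k ∙ b ∙ h)   ≈⟨ assoc _ _ _ ⟨
      k ∙ (a ∙ b ⁻¹) ∙ k ⁻¹ ∙ (k ∙ b) ∙ h   ≈⟨ ∙-congʳ (∙-congʳ (∙-congʳ (assoc k a (b ⁻¹)))) ⟨
      k ∙ a ∙ b ⁻¹ ∙ k ⁻¹ ∙ (k ∙ b) ∙ h     ≈⟨ ∙-congʳ (∙-congʳ (assoc _ _ _)) ⟩
      k ∙ a ∙ (b ⁻¹ ∙ k ⁻¹) ∙ (k ∙ b) ∙ h   ≈⟨ ∙-congʳ (∙-congʳ (∙-congˡ (⁻¹-anti-homo-∙ k b))) ⟨
      k ∙ a ∙ (k ∙ b) ⁻¹ ∙ (k ∙ b) ∙ h      ≈⟨ ∙-congʳ (assoc _ _ _) ⟩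
      k ∙ a ∙ ((k ∙ b) ⁻¹ ∙ (k ∙ b)) ∙ h    ≈⟨ ∙-congʳ (∙-congˡ (inverseˡ (k ∙ b))) ⟩
      k ∙ a ∙ ε ∙ h                         ≈⟨ ∙-congʳ (identityʳ (k ∙ a)) ⟩
      k ∙ a ∙ h                             ∎
      where open SetoidReasoning setoid

module _ {G : PolishGroup} (X : PolishGSpace G) where
  private module G = PolishGroup G
  open PolishGSpace X

  RightEmbeds-resp : ∀ {x y x′ y′} → OrbitEq x y → OrbitEq y′ x′ →
                     RightEmbeds x x′ → RightEmbeds y y′
  RightEmbeds-resp {x} {y} {x′} {y′} (k , kx≈y) (h , hy′≈x′) (s , cauchy , conv) =
    (λ n → k G.∙ s n G.∙ h) , RightCauchy-translate G k h cauchy , λ U oU y∈U →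
      let (_ , V , _ , oV , k∈ , x∈V , ⊆U) =
            proj₂ (·-continuous oU) k x (Open⇒resp-≈ oU (sym kx≈y) y∈U)
          (N , eventually) = conv V oV x∈V
      in N , λ n N≤n → Open⇒resp-≈ oU (eq n) (⊆U {k , s n · x′} (k∈ , eventually n N≤n))
    where
    eq : ∀ n → k · s n · x′ ≈ (k G.∙ s n G.∙ h) · y′
    eq n = begin
      k · s n · x′              ≈⟨ ·-cong G.refl (·-cong G.refl hy′≈x′) ⟨
      k · s n · h · y′          ≈⟨ ·-assoc k (s n) (h · y′) ⟨
      (k G.∙ s n) · h · y′      ≈⟨ ·-assoc (k G.∙ s n) h y′ ⟨
      (k G.∙ s n G.∙ h) · y′    ∎
      where open SetoidReasoning setoid

------------------------------------------------------------------------
-- Digraphs and the Becker digraph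

record Digraph : Set₂ where
  infix 4 _⟶_
  field
    vertices : Setoid 0ℓ 0ℓ
  open Setoid vertices public
  field
    _⟶_    : Rel Carrier 1ℓ
    ⟶-resp : _⟶_ Respects₂ _≈_

record IsDigraphIsomorphism (A B : Digraph)
       (φ : Digraph.Carrier A → Digraph.Carrier B) : Set₁ where
  private
    module A = Digraph A
    module B = Digraph B
  field
    isBijection : IsBijection A._≈_ B._≈_ φ
    arrows      : ∀ u v → (u A.⟶ v) ⇔ (φ u B.⟶ φ v)

-- 𝓑(C/G): the quotient C/G is the setoid of points of C up to E^G_X.
Becker : ∀ {G} (X : PolishGSpace G) → Pred (PolishGSpace.Carrier X) 0ℓ → Digraph
Becker X C = record
  { vertices = On.setoid {B = Σ Carrier C} orbits proj₁
  ; _⟶_      = λ (x , _) (x′ , _) → RightEmbeds x x′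
  ; ⟶-resp   = (λ y≈y′ → RightEmbeds-resp X O.refl (O.sym y≈y′))
             , (λ x≈x′ → RightEmbeds-resp X x≈x′ O.refl)
  }
  where
  open PolishGSpace X
  module O = Setoid orbits

------------------------------------------------------------------------
-- *-reductions between orbit equivalence relations

module _ (S T : TopologicalSpace) where
  private
    module S = TopologicalSpace S
    module T = TopologicalSpace T

  BaireMeasurableMap : (S.Carrier → T.Carrier) → Set₁
  BaireMeasurableMap f = ∀ U → T.Open U → BaireMeasurable S (f ⊢ U)

  CategoryPreserving : (S.Carrier → T.Carrier) → Set₁
  CategoryPreserving f = ∀ M → Meager T M → Meager S (f ⊢ M)

  record IsStarReduction (E : Rel S.Carrier 0ℓ) (F : Rel T.Carrier 0ℓ)
                         (f : Func S.setoid T.setoid) : Set₁ where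
    open Func f
    field
      baireMeasurable    : BaireMeasurableMap to
      categoryPreserving : CategoryPreserving to
      reduction          : ∀ x x′ → E x x′ ⇔ F (to x) (to x′)

module Submission where

open import Defs
open import Algebra.Bundles using (Group)
open import Axiom.ExcludedMiddle using (ExcludedMiddle)
import Data.Integer.Base as ℤ
import Data.Integer.Properties as ℤ
open import Data.List.Base using (List; []; _∷_; length)
open import Data.Maybe.Base using (just; nothing)
open import Data.Nat.Base as ℕ using (ℕ; zero; suc; _+_)
import Data.Nat.Properties as ℕ
open import Data.Product.Base using (Σ; ∃; _×_; _,_; proj₁; proj₂)
open import Data.Rational.Base as ℚ using (ℚ; 0ℚ; 1ℚ; ½; mkℚ)
import Data.Rational.Properties as ℚ
open import Data.Rational.Solver using (module +-*-Solver)
import Data.Rational.Unnormalised.Base as ℚᵘ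
import Data.Rational.Unnormalised.Properties as ℚᵘ
open import Data.Sum.Base using (_⊎_; inj₁; inj₂; [_,_]′)
open import Data.Unit.Base using (⊤; tt)
open import Function.Base using (_∘_; id)
open import Function.Bundles using (Func; _⇔_; mk⇔; Equivalence)
open import Function.Metric.Structures using (module IsGeneralMetric)
open import Level using (Level; 0ℓ; _⊔_)
open import Relation.Binary.Bundles using (Setoid)
open import Relation.Binary.Definitions using (_Respects_; tri<; tri≈; tri>)
open import Relation.Binary.PropositionalEquality.Core as ≡ using (_≡_; subst; cong)
open import Relation.Binary.Structures using (IsEquivalence)
open import Relation.Nullary.Decidable using (yes; no; True; toWitness; fromWitness)
open import Relation.Nullary.Negation.Core using (¬_; contradiction)
open import Relation.Unary using (Pred; _∈_; _∉_; _⊆_; _∩_; _∪_; U; ⋂; _⟨×⟩_)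

-- Let f be continuous on a dense Gδ set C.  The relation "f (g x) lies in W f(x)"
-- is analytic in X × G, hence agrees with a regular open set up to a meager set,
-- and for generic x that open set contains (x, ε) as soon as W contains ε.  So if
-- gₙ x′ → x with (gₙ) right-Cauchy and x, x′ generic, the gₙ may be moved to
-- generic hₙ along which f (hₙ₊₁ x′) = wₙ f (hₙ x′) with wₙ as close to ε as wished;
-- the products of the wₙ witness that f x right-embeds in f x′.  In the other
-- direction the same argument applies to a map ψ defined on the saturation of
-- f(C) which inverts f on orbits and is generically continuous; f being category
-- preserving, generic orbits of X go to orbits which are generic for ψ.

-- The w with f (g x) = w f x need not be unique, as stabilisers may be large, so there is no
-- cocycle to continue along. What survives is qualitative: for each basic set of H, the pairs (x,
-- g) that admit a w in it form a set with the Baire property. One Souslin construction serves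
-- twice. Its hulls show that analytic sets have the Baire property, and its leftmost branches are
-- locally constant on typical points, which makes ψ continuous there. The domain of ψ is comeager
-- only in some open set that may fail to be dense. The transfer of embeddings is therefore proved
-- for maps on any Gδ set, and asks that the two orbits in question lie generically inside it.
-- Comeagerness is a large proposition. A countable base keeps the open sets that witness it small,
-- and so keeps X₀ and Y₀ small. Finally, a right-Cauchy sequence has to come with a compatible
-- right-invariant metric, hence the Birkhoff-Kakutani theorem.

record Enumeration (J : Set) : Set where
  field
    at   : ℕ → J
    onto : ∀ j → ∃ λ n → at n ≡ j

open Enumeration

-- Walks each antidiagonal from (s, 0) to (0, s), then jumps to (s + 1, 0).
unpair : ℕ → ℕ × ℕ
unpair zero = 0 , 0
unpair (suc n) with unpair n
... | zero  , b = suc b , 0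
... | suc a , b = a , suc b

unpair-along : ∀ b {n a c} → unpair n ≡ (b + a , c) → ∃ λ k → unpair k ≡ (a , b + c)
unpair-along zero {n} eq = n , eq
unpair-along (suc b) {n} {a} {c} eq =
  let (k , eq′) = unpair-along b {suc n} {a} {suc c} next
  in k , ≡.trans eq′ (cong (a ,_) (ℕ.+-suc b c))
  where
  next : unpair (suc n) ≡ (b + a , suc c)
  next rewrite eq = ≡.refl

unpair-axis : ∀ s → ∃ λ k → unpair k ≡ (s , 0)
unpair-axis zero = 0 , ≡.refl
unpair-axis (suc s) =
  let (k , eq) = unpair-axis s
      (k′ , eq′) = unpair-along s {k} {0} {0} (≡.trans eq (cong (_, 0) (≡.sym (ℕ.+-identityʳ s))))
  in suc k′ , next k′ eq′
  where
  next : ∀ k → unpair k ≡ (0 , s + 0) → unpair (suc k) ≡ (suc s , 0)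
  next k eq rewrite eq = cong (λ t → suc t , 0) (ℕ.+-identityʳ s)

pair : ∀ a b → ∃ λ k → unpair k ≡ (a , b)
pair a b =
  let (k , eq) = unpair-axis (b + a)
      (k′ , eq′) = unpair-along b {k} {a} {0} eq
  in k′ , ≡.trans eq′ (cong (a ,_) (ℕ.+-identityʳ b))

ℕ-enum : Enumeration ℕ
ℕ-enum = record { at = id ; onto = λ n → n , ≡.refl }

_×-enum_ : ∀ {I J} → Enumeration I → Enumeration J → Enumeration (I × J)
(e ×-enum e′) .at k = at e (proj₁ (unpair k)) , at e′ (proj₂ (unpair k))
(e ×-enum e′) .onto (i , j) with onto e i | onto e′ j
... | a , ≡.refl | b , ≡.refl =
  let (k , eq) = pair a b in k , cong (λ (m , n) → at e m , at e′ n) eq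

_⊎-enum_ : ∀ {I J} → Enumeration I → Enumeration J → Enumeration (I ⊎ J)
_⊎-enum_ {I} {J} e e′ = record { at = pick ∘ unpair ; onto = found }
  where
  pick : ℕ × ℕ → I ⊎ J
  pick (zero  , b) = inj₁ (at e b)
  pick (suc _ , b) = inj₂ (at e′ b)
  found : ∀ j → ∃ λ n → pick (unpair n) ≡ j
  found (inj₁ i) = let (b , eq) = onto e i ; (k , eq′) = pair 0 b
                   in k , ≡.trans (cong pick eq′) (cong inj₁ eq)
  found (inj₂ j) = let (b , eq) = onto e′ j ; (k , eq′) = pair 1 b
                   in k , ≡.trans (cong pick eq′) (cong inj₂ eq)

-- Baire category

record Base (S : Set) : Set₁ where
  field
    B        : ℕ → Pred S 0ℓ
    nonempty : ∀ m → ∃ (B m)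
    cover    : ∀ x → ∃ λ m → x ∈ B m
    meet     : ∀ {m n x} → x ∈ B m → x ∈ B n →
               ∃ λ k → x ∈ B k × B k ⊆ B m × B k ⊆ B n

  IsOpen : ∀ {ℓ} → Pred S ℓ → Set ℓ
  IsOpen V = ∀ {x} → x ∈ V → ∃ λ m → x ∈ B m × B m ⊆ V

  IsDense : ∀ {ℓ} → Pred S ℓ → Set ℓ
  IsDense V = ∀ m → ∃ λ x → x ∈ B m × x ∈ V

  cl ext : Pred S 0ℓ → Pred S 0ℓ
  cl P x = ∀ m → x ∈ B m → ∃ λ z → z ∈ B m × z ∈ P
  ext P x = ∃ λ m → x ∈ B m × ∀ {z} → z ∈ B m → z ∉ P

  B-open : ∀ m → IsOpen (B m)
  B-open m x∈ = m , x∈ , id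

  U-open : IsOpen (U {A = S})
  U-open {x} _ = let (m , x∈) = cover x in m , x∈ , λ _ → tt

  ∩-open : ∀ {ℓ ℓ′} {V : Pred S ℓ} {W : Pred S ℓ′} → IsOpen V → IsOpen W → IsOpen (V ∩ W)
  ∩-open oV oW (x∈V , x∈W) =
    let (m , x∈m , m⊆) = oV x∈V
        (n , x∈n , n⊆) = oW x∈W
        (k , x∈k , k⊆m , k⊆n) = meet x∈m x∈n
    in k , x∈k , λ z → m⊆ (k⊆m z) , n⊆ (k⊆n z)

  ∪-open : ∀ {ℓ ℓ′} {V : Pred S ℓ} {W : Pred S ℓ′} → IsOpen V → IsOpen W → IsOpen (V ∪ W)
  ∪-open oV oW (inj₁ x∈V) = let (m , x∈m , m⊆) = oV x∈V in m , x∈m , inj₁ ∘ m⊆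
  ∪-open oV oW (inj₂ x∈W) = let (m , x∈m , m⊆) = oW x∈W in m , x∈m , inj₂ ∘ m⊆

  ⋃-open : ∀ {i ℓ} {I : Set i} {V : I → Pred S ℓ} → (∀ i → IsOpen (V i)) →
           IsOpen (λ x → ∃ λ i → x ∈ V i)
  ⋃-open oV (i , x∈) = let (m , x∈m , m⊆) = oV i x∈ in m , x∈m , λ z → i , m⊆ z

  ext-open : ∀ P → IsOpen (ext P)
  ext-open P (m , x∈ , m∩P) = m , x∈ , λ z → m , z , m∩P

  -- `P` may live in any universe while the witnessing open sets stay small. This allows comeager
  -- sets of points at which something else is comeager, and lets `X₀` be built from the witnesses.
  record Comeager {ℓ} (P : Pred S ℓ) : Set (Level.suc 0ℓ ⊔ ℓ) where
    pattern
    constructor comeager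
    field
      O      : ℕ → Pred S 0ℓ
      O-open : ∀ n → IsOpen (O n)
      O-dense : ∀ n → IsDense (O n)
      O⊆     : ∀ {x} → (∀ n → x ∈ O n) → x ∈ P

  private variable
    ℓ ℓ′ : Level
    P : Pred S ℓ
    Q : Pred S ℓ′

  com-mono : P ⊆ Q → Comeager P → Comeager Q
  com-mono P⊆Q (comeager O o d ⊆P) = comeager O o d (P⊆Q ∘ ⊆P)

  com-open : ∀ {V : Pred S 0ℓ} → IsOpen V → IsDense V → Comeager V
  com-open {V} oV dV = comeager (λ _ → V) (λ _ → oV) (λ _ → dV) (λ x∈ → x∈ 0)

  com-always : (∀ x → P x) → Comeager P
  com-always all = comeager (λ _ → U) (λ _ → U-open)
    (λ _ m → let (x , x∈) = nonempty m in x , x∈ , tt) (λ {x} _ → all x)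

  com-⋂ : ∀ {J} {Q : J → Pred S ℓ} → Enumeration J →
          (∀ j → Comeager (Q j)) → Comeager (λ x → ∀ j → x ∈ Q j)
  com-⋂ {Q = Q} e c = comeager
    (λ k → Comeager.O (c (at e (proj₁ (unpair k)))) (proj₂ (unpair k)))
    (λ k → Comeager.O-open (c _) _)
    (λ k → Comeager.O-dense (c _) _)
    λ {x} x∈ j → let (a , eq) = onto e j in subst (λ j → x ∈ Q j) eq
      (Comeager.O⊆ (c _) λ n → let (k , eq′) = pair a n in
        subst (λ (a , n) → x ∈ Comeager.O (c (at e a)) n) eq′ (x∈ k))

  com-∩ : Comeager P → Comeager Q → Comeager (P ∩ Q)
  com-∩ {P = P} {Q = Q} p q = comeager
    (λ k → choose (unpair k)) (λ k → o (unpair k)) (λ k → d (unpair k))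
    λ {x} x∈ →
      Comeager.O⊆ p (λ n → let (k , eq) = pair 0 n in subst (λ t → x ∈ choose t) eq (x∈ k)) ,
      Comeager.O⊆ q (λ n → let (k , eq) = pair 1 n in subst (λ t → x ∈ choose t) eq (x∈ k))
    where
    choose : ℕ × ℕ → Pred S 0ℓ
    choose (zero  , n) = Comeager.O p n
    choose (suc _ , n) = Comeager.O q n
    o : ∀ t → IsOpen (choose t)
    o (zero  , n) = Comeager.O-open p n
    o (suc _ , n) = Comeager.O-open q n
    d : ∀ t → IsDense (choose t)
    d (zero  , n) = Comeager.O-dense p n
    d (suc _ , n) = Comeager.O-dense q n

  -- Lists are handled length by length, each length by iterated countable intersections.
  com-List : ∀ {Q : List ℕ → Pred S ℓ} → (∀ s → Comeager (Q s)) →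
             Comeager (λ x → ∀ s → x ∈ Q s)
  com-List {Q = Q} c = com-mono (λ all s → all (length s) s ≡.refl)
    (com-⋂ ℕ-enum (λ n → of-length n Q c))
    where
    of-length : ∀ n (Q : List ℕ → Pred S ℓ) → (∀ s → Comeager (Q s)) →
                Comeager (λ x → ∀ s → length s ≡ n → x ∈ Q s)
    of-length zero    Q c = com-mono (λ { q [] _ → q }) (c [])
    of-length (suc n) Q c = com-mono (λ { q (i ∷ s) eq → q i s (ℕ.suc-injective eq) })
      (com-⋂ ℕ-enum (λ i → of-length n (λ s → Q (i ∷ s)) (λ s → c (i ∷ s))))


-- Classical logic: resizing and least witnesses

module Choice (em : ∀ {ℓ} → ExcludedMiddle ℓ) where

  -- Excluded middle resizes every proposition to the lowest universe.
  Small : ∀ {ℓ} → Set ℓ → Set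
  Small Q = True (em {P = Q})

  small : ∀ {ℓ} {Q : Set ℓ} → Q → Small Q
  small = fromWitness

  unsmall : ∀ {ℓ} {Q : Set ℓ} → Small Q → Q
  unsmall = toWitness

  by-contradiction : ∀ {ℓ} {Q : Set ℓ} → ¬ ¬ Q → Q
  by-contradiction {Q = Q} ¬¬q with em {P = Q}
  ... | yes q = q
  ... | no ¬q = contradiction ¬q ¬¬q

  Least : Pred ℕ 0ℓ → ℕ → Set
  Least P n = n ∈ P × ∀ {j} → j ℕ.< n → j ∉ P

  least : ∀ {P} n → n ∈ P → ∃ (Least P)
  least {P} n n∈ = search n 0 (subst (_∈ P) (≡.sym (ℕ.+-identityʳ n)) n∈) λ ()
    where
    search : ∀ d k → d + k ∈ P → (∀ {j} → j ℕ.< k → j ∉ P) → ∃ (Least P)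
    search zero    k k∈ below = k , k∈ , below
    search (suc d) k dk∈ below with em {P = k ∈ P}
    ... | yes k∈ = k , k∈ , below
    ... | no  k∉ = search d (suc k) (subst (_∈ P) (≡.sym (ℕ.+-suc d k)) dk∈) λ j<sk j∈ →
      [ (λ j<k → below j<k j∈) , (λ { ≡.refl → k∉ j∈ }) ]′ (ℕ.m<1+n⇒m<n∨m≡n j<sk)

  least-unique : ∀ {P m n} → Least P m → Least P n → m ≡ n
  least-unique {m = m} {n} (m∈ , <m) (n∈ , <n) with ℕ.<-cmp m n
  ... | tri< m<n _ _ = contradiction m∈ (<n m<n)
  ... | tri≈ _ m≡n _ = m≡n
  ... | tri> _ _ n<m = contradiction n∈ (<m n<m)

module Category (em : ∀ {ℓ} → ExcludedMiddle ℓ) {S : Set} (base : Base S) where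
  open Choice em
  open Base base

  -- The boundary of an open set is nowhere dense.
  decide-ext : ∀ {V : Pred S 0ℓ} → IsOpen V → Comeager (V ∪ ext V)
  decide-ext {V} oV = com-open (∪-open oV (ext-open V)) dense
    where
    dense : IsDense (V ∪ ext V)
    dense m with em {P = ∃ λ x → x ∈ B m × x ∈ V}
    ... | yes (x , x∈m , x∈V) = x , x∈m , inj₁ x∈V
    ... | no none = let (x , x∈) = nonempty m in
      x , x∈ , inj₂ (m , x∈ , λ z∈m z∈V → none (_ , z∈m , z∈V))

  -- thin P is the largest open set in which P is meager.
  thin hull : Pred S 0ℓ → Pred S 0ℓ
  thin P x = ∃ λ m → Small (Comeager (λ y → y ∈ B m → y ∉ P)) × x ∈ B m
  hull P = ext (thin P)

  thin-open : ∀ P → IsOpen (thin P)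
  thin-open P (m , meager , x∈) = m , x∈ , λ z∈ → m , meager , z∈

  hull-open : ∀ P → IsOpen (hull P)
  hull-open P = ext-open (thin P)

  -- Exteriors are regular open: a point of `thin P` in `B m` would have a basic neighbourhood
  -- inside both, and `hull P`, being dense in `B m`, would meet it.
  hull-regular : ∀ P m → (∀ n → B n ⊆ B m → ∃ λ x → x ∈ B n × x ∈ hull P) → B m ⊆ hull P
  hull-regular P m dense x∈ = m , x∈ , λ z∈m z∈thin →
    let (k , z∈k , k⊆m , k⊆thin) = smaller z∈m z∈thin
        (y , y∈k , n , y∈n , n∩thin) = dense k k⊆m
    in n∩thin y∈n (k⊆thin y∈k)
    where
    smaller : ∀ {z} → z ∈ B m → z ∈ thin P → ∃ λ k → z ∈ B k × B k ⊆ B m × B k ⊆ thin P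
    smaller z∈m z∈thin =
      let (n , z∈n , n⊆) = thin-open P z∈thin
          (k , z∈k , k⊆m , k⊆n) = meet z∈m z∈n
      in k , z∈k , k⊆m , n⊆ ∘ k⊆n

  thin-or-hull : ∀ P → Comeager (thin P ∪ hull P)
  thin-or-hull P = decide-ext (thin-open P)

  -- With a countable base, this case of the Banach category theorem is a countable intersection.
  thin-meager : ∀ P → Comeager (λ x → x ∈ thin P → x ∉ P)
  thin-meager P = com-mono (λ f (m , meager , x∈) → f m meager x∈) (com-⋂ ℕ-enum each)
    where
    each : ∀ m → Comeager (λ x → Small (Comeager (λ y → y ∈ B m → y ∉ P)) → x ∈ B m → x ∉ P)
    each m with em {P = Comeager (λ y → y ∈ B m → y ∉ P)}
    ... | yes meager = com-mono (λ f _ → f) meager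
    ... | no _ = com-always λ _ ()

  ⊆-hull : ∀ P → Comeager (λ x → x ∈ P → x ∈ hull P)
  ⊆-hull P = com-mono (λ (m , s) x∈P → [ (λ t → contradiction x∈P (m t)) , id ]′ s)
    (com-∩ (thin-meager P) (thin-or-hull P))

  hull⊆cl : ∀ P → hull P ⊆ cl P
  hull⊆cl P (n , x∈n , n∩thin) m x∈m = by-contradiction λ none →
    n∩thin x∈n (m , small (com-always λ z z∈m z∈P → none (z , z∈m , z∈P)) , x∈m)

  -- Outside the closure of the union of the hulls, every Q n and hence P is meager.
  hull-⋃ : ∀ {P} {Q : ℕ → Pred S 0ℓ} → (∀ {x} → x ∈ P → ∃ λ n → x ∈ Q n) →
           Comeager (λ x → x ∈ hull P → ∃ λ n → x ∈ hull (Q n))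
  hull-⋃ {P} {Q} P⊆⋃Q = com-mono
    (λ { (inj₁ x∈E) _ → x∈E
       ; (inj₂ (m , x∈m , m∩E)) (n , x∈n , n∩thin) →
           contradiction (m , small (meager m∩E) , x∈m) (n∩thin x∈n) })
    (decide-ext (⋃-open (λ n → hull-open (Q n))))
    where
    meager : ∀ {m} → (∀ {z} → z ∈ B m → z ∉ (λ x → ∃ λ n → x ∈ hull (Q n))) →
             Comeager (λ y → y ∈ B m → y ∉ P)
    meager m∩E = com-mono
      (λ f y∈m y∈P → let (n , y∈Q) = P⊆⋃Q y∈P in
        [ (λ y∈thin → proj₂ (f n) y∈thin y∈Q) , (λ y∈hull → m∩E y∈m (n , y∈hull)) ]′
          (proj₁ (f n)))
      (com-⋂ ℕ-enum (λ n → com-∩ (thin-or-hull (Q n)) (thin-meager (Q n))))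

-- A Souslin representation of the image of φ: the sets cell s form a tree
-- of pieces of R, refining all the covers c j.
module Souslin (em : ∀ {ℓ} → ExcludedMiddle ℓ) {S R J : Set} (base : Base S)
               (enum : Enumeration J) (c : J → ℕ → Pred R 0ℓ)
               (covers : ∀ j r → ∃ λ i → r ∈ c j i) (φ : R → S) where
  open Choice em
  open Base base
  open Category em base

  -- The head is the newest choice. At depth k it picks a piece of the cover numbered k, so every
  -- infinite branch refines all the covers.
  cell : List ℕ → Pred R 0ℓ
  cell []      _ = ⊤
  cell (n ∷ s) r = r ∈ c (at enum (length s)) n × r ∈ cell s

  image : List ℕ → Pred S 0ℓ
  image s y = ∃ λ r → r ∈ cell s × φ r ≡ y

  H : List ℕ → Pred S 0ℓ
  H s = hull (image s)

  -- The clauses say that a branch through the hulls never gets stuck at y, that y is on the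
  -- boundary of no hull, and that y is in the root hull if it is in the image.
  Typical : Pred S 0ℓ
  Typical y = (∀ s → y ∈ H s → ∃ λ n → y ∈ H (n ∷ s)) × (∀ s → y ∈ H s ∪ ext (H s)) ×
              (∀ r → φ r ≡ y → y ∈ H [])

  typical : Comeager Typical
  typical = com-∩ (com-List λ s → hull-⋃ λ (r , r∈s , eq) →
                     let (n , r∈n) = covers _ r in n , r , (r∈n , r∈s) , eq)
           (com-∩ (com-List λ s → decide-ext (hull-open (image s)))
                  (com-mono (λ f r eq → f (r , tt , eq)) (⊆-hull (image []))))

  next : S → List ℕ → ℕ
  next y s with em {P = ∃ λ n → y ∈ H (n ∷ s)}
  ... | yes (n , y∈) = proj₁ (least {λ n → y ∈ H (n ∷ s)} n y∈)
  -- Arbitrary: along the branch of a typical point of the root hull this case does not occur.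
  ... | no _ = 0

  path : S → ℕ → List ℕ
  path y zero = []
  path y (suc k) = next y (path y k) ∷ path y k

  next-least : ∀ y s → ∃ (λ n → y ∈ H (n ∷ s)) → Least (λ n → y ∈ H (n ∷ s)) (next y s)
  next-least y s some with em {P = ∃ λ n → y ∈ H (n ∷ s)}
  ... | yes (n , y∈) = proj₂ (least {λ n → y ∈ H (n ∷ s)} n y∈)
  ... | no none = contradiction some none

  path-length : ∀ y k → length (path y k) ≡ k
  path-length y zero = ≡.refl
  path-length y (suc k) = cong suc (path-length y k)

  module _ {y} (y∈H : y ∈ H []) (y-typical : y ∈ Typical) where

    path-hull : ∀ k → y ∈ H (path y k)
    path-hull zero = y∈H
    path-hull (suc k) =
      proj₁ (next-least y (path y k) (proj₁ y-typical (path y k) (path-hull k)))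

    next-minimal : ∀ k → Least (λ n → y ∈ H (n ∷ path y k)) (next y (path y k))
    next-minimal k = next-least y (path y k) (proj₁ y-typical (path y k) (path-hull k))

    Pieces : ℕ → Pred R 0ℓ
    Pieces k = cell (path y k)

    -- So far y is only known to be in the closures of the images along its branch; passing to a
    -- limit of the pieces turns this into membership.
    pieces-cl : ∀ k m → y ∈ B m → ∃ λ r → r ∈ Pieces k × φ r ∈ B m
    pieces-cl k m y∈m with hull⊆cl (image (path y k)) (path-hull k) m y∈m
    ... | _ , φr∈m , r , r∈ , ≡.refl = r , r∈ , φr∈m

    pieces-decreasing : ∀ k → Pieces (suc k) ⊆ Pieces k
    pieces-decreasing k = proj₂

    pieces-fine : ∀ j → ∃ λ i → ∃ λ k → Pieces k ⊆ c j i
    pieces-fine j =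
      let (k , eq) = onto enum j in
      next y (path y k) , suc k , λ {r} (r∈ , _) →
        subst (λ j → r ∈ c j (next y (path y k)))
          (≡.trans (cong (at enum) (path-length y k)) eq) r∈

  avoid : ∀ {y} (V : ℕ → Pred S 0ℓ) n → (∀ {j} → j ℕ.< n → y ∈ ext (V j)) →
          ∃ λ m → y ∈ B m × ∀ {z} → z ∈ B m → ∀ {j} → j ℕ.< n → z ∉ V j
  avoid {y} V zero _ = let (m , y∈) = cover y in m , y∈ , λ _ ()
  avoid V (suc n) ext-V =
    let (m , y∈m , m-avoids) = avoid V n (ext-V ∘ ℕ.m<n⇒m<1+n)
        (m′ , y∈m′ , m′-avoids) = ext-V (ℕ.n<1+n n)
        (k , y∈k , k⊆m , k⊆m′) = meet y∈m y∈m′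
    in k , y∈k , λ z∈ {j} j<1+n z∈V →
      [ (λ j<n → m-avoids (k⊆m z∈) j<n z∈V) , (λ { ≡.refl → m′-avoids (k⊆m′ z∈) z∈V }) ]′
        (ℕ.m<1+n⇒m<n∨m≡n j<1+n)

  -- The least admissible child is fixed by finitely many open conditions: y lies in the chosen hull
  -- and, being typical, in the exteriors of the earlier ones. So the leftmost branch depends
  -- continuously on the point.
  path-locally-constant : ∀ {y} → y ∈ H [] → y ∈ Typical → ∀ k →
    ∃ λ m → y ∈ B m × ∀ {z} → z ∈ B m → z ∈ H [] → z ∈ Typical → path z k ≡ path y k
  path-locally-constant {y} _ _ zero =
    let (m , y∈) = cover y in m , y∈ , λ _ _ _ → ≡.refl
  path-locally-constant {y} y∈H ty@(_ , dec , _) (suc k) =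
    let
      s = path y k
      (y∈n , below) = next-minimal y∈H ty k
      (m₁ , y∈m₁ , same) = path-locally-constant y∈H ty k
      (m₂ , y∈m₂ , m₂⊆) = hull-open (image (next y s ∷ s)) y∈n
      (m₃ , y∈m₃ , m₃-avoids) = avoid (λ n → H (n ∷ s)) (next y s) λ {j} j<n →
        [ (λ y∈ → contradiction y∈ (below j<n)) , id ]′ (dec (j ∷ s))
      (k₁ , y∈k₁ , k₁⊆m₁ , k₁⊆m₂) = meet y∈m₁ y∈m₂
      (k₂ , y∈k₂ , k₂⊆k₁ , k₂⊆m₃) = meet y∈k₁ y∈m₃
    in k₂ , y∈k₂ , λ {z} z∈ z∈H tz →
      let eq = same (k₁⊆m₁ (k₂⊆k₁ z∈)) z∈H tz
          z-next : Least (λ n → z ∈ H (n ∷ s)) (next z s)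
          z-next = subst (λ s → Least (λ n → z ∈ H (n ∷ s)) (next z s)) eq (next-minimal z∈H tz k)
      in ≡.trans (cong (λ s → next z s ∷ s) eq) (cong (_∷ s)
           (least-unique z-next (m₂⊆ (k₁⊆m₂ (k₂⊆k₁ z∈)) , m₃-avoids (k₂⊆m₃ z∈))))

-- Polish spaces, groups and actions

record Shrinking {R : Set} (T : ℕ → Pred R 0ℓ) : Set where
  field
    inhabited  : ∀ k → ∃ (T k)
    decreasing : ∀ k → T (suc k) ⊆ T k

  decreasing-≤ : ∀ {k n} → k ℕ.≤ n → T n ⊆ T k
  decreasing-≤ {k} {n} k≤n = go (ℕ.≤⇒≤′ k≤n)
    where
    go : ∀ {n} → k ℕ.≤′ n → T n ⊆ T k
    go (ℕ.≤′-reflexive ≡.refl) = id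
    go (ℕ.≤′-step k≤n) = go k≤n ∘ decreasing _

  common : ∀ k n → ∃ λ r → r ∈ T k × r ∈ T n
  common k n = let (r , r∈) = inhabited (k ℕ.⊔ n) in
    r , decreasing-≤ (ℕ.m≤m⊔n k n) r∈ , decreasing-≤ (ℕ.m≤n⊔m k n) r∈

-- A Polish space, presented by a countable base; the j-th row of tiles is
-- a cover by sets of diameter at most about 2⁻ʲ.
record PolishBase (X : Setoid 0ℓ 0ℓ) : Set₁ where
  open Setoid X
  field
    base : Base Carrier
  open Base base public
  field
    B-resp     : ∀ m → B m Respects _≈_
    regular    : ∀ {m x} → x ∈ B m → ∃ λ k → x ∈ B k × cl (B k) ⊆ B m
    T₀         : ∀ {x y} → (∀ m → x ∈ B m → y ∈ B m) → x ≈ y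
    tile       : ℕ → ℕ → ℕ
    tile-cover : ∀ j x → ∃ λ i → x ∈ B (tile j i)
    complete   : ∀ (T : ℕ → Pred Carrier 0ℓ) → Shrinking T →
                 (∀ j → ∃ λ i → ∃ λ k → T k ⊆ B (tile j i)) →
                 ∃ λ z → ∀ {m} → z ∈ B m → ∃ λ k → T k ⊆ B m

  open-resp : ∀ {ℓ} {V : Pred Carrier ℓ} → IsOpen V → V Respects _≈_
  open-resp oV x≈y x∈V = let (m , x∈ , m⊆) = oV x∈V in m⊆ (B-resp m x≈y x∈)

  hausdorff : ∀ {x y} → (∀ {m n} → x ∈ B m → y ∈ B n → ∃ λ z → z ∈ B m × z ∈ B n) → x ≈ y
  hausdorff meets = T₀ λ m x∈m →
    let (k , x∈k , cl⊆) = regular x∈m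
    in cl⊆ λ n y∈n → let (z , z∈k , z∈n) = meets x∈k y∈n in z , z∈n , z∈k

  -- `P` may fail to respect `≈`, but the open sets witnessing comeagerness respect it.
  com-≈ : ∀ {ℓ} {P : Pred Carrier ℓ} → Comeager P → Comeager (λ x → ∀ {y} → x ≈ y → y ∈ P)
  com-≈ (comeager O o d ⊆P) = comeager O o d λ x∈ x≈y → ⊆P λ n → open-resp (o n) x≈y (x∈ n)

  module _ {R : Set} (π : R → Carrier) where

    Limit : (ℕ → Pred R 0ℓ) → Carrier → Set
    Limit T z = ∀ {m} → z ∈ B m → ∃ λ k → ∀ {r} → r ∈ T k → π r ∈ B m

    tiles : ℕ → ℕ → Pred R 0ℓ
    tiles j i r = π r ∈ B (tile j i)

    -- Since the closure of `B i` is inside `V`, limits of points of one piece are still in `V`.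
    -- Covers of this kind preserve Gδ conditions along branches.
    inside : Pred Carrier 0ℓ → ℕ → Pred R 0ℓ
    inside V i r = cl (B i) ⊆ V × π r ∈ B i

    tiles-cover : ∀ j r → ∃ λ i → r ∈ tiles j i
    tiles-cover j r = tile-cover j (π r)

    inside-cover : ∀ {V} → IsOpen V → ∀ {r} → π r ∈ V → ∃ λ i → r ∈ inside V i
    inside-cover oV r∈ =
      let (m , r∈m , m⊆V) = oV r∈
          (k , r∈k , cl⊆m) = regular r∈m
      in k , (λ z∈ → m⊆V (cl⊆m z∈)) , r∈k

    module _ {T : ℕ → Pred R 0ℓ} (T↓ : Shrinking T) where
      open Shrinking T↓

      limit : (∀ j → ∃ λ i → ∃ λ k → T k ⊆ tiles j i) → ∃ (Limit T)
      limit T-fine =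
        let (z , T→z) = complete (λ k z → ∃ λ r → r ∈ T k × π r ≡ z)
              (record { inhabited = λ k → let (r , r∈) = inhabited k in π r , r , r∈ , ≡.refl
                      ; decreasing = λ k (r , r∈ , eq) → r , decreasing k r∈ , eq })
              (λ j → let (i , k , T⊆) = T-fine j in i , k , λ { (r , r∈ , ≡.refl) → T⊆ r∈ })
        in z , λ z∈ → let (k , T⊆) = T→z z∈ in k , λ r∈ → T⊆ (_ , r∈ , ≡.refl)

      limit-cl : ∀ {z V} → Limit T z → ∀ k → (∀ {r} → r ∈ T k → π r ∈ V) → z ∈ cl V
      limit-cl T→z k T⊆V m z∈m =
        let (n , T⊆m) = T→z z∈m
            (r , r∈k , r∈n) = common k n
        in π r , T⊆m r∈n , T⊆V r∈k

      limit-inside : ∀ {z V} → Limit T z → (∃ λ i → ∃ λ k → T k ⊆ inside V i) → z ∈ V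
      limit-inside T→z (i , k , T⊆) =
        let (r , r∈) = inhabited k
        in proj₁ (T⊆ r∈) (limit-cl T→z k (λ r∈ → proj₂ (T⊆ r∈)))

  -- Nested basic sets are chosen whose closures enter the dense open sets one after the other;
  -- entering a tile of every row makes them converge.
  baire : ∀ {ℓ} {P : Pred Carrier ℓ} → Comeager P → ∀ m → ∃ λ x → x ∈ B m × x ∈ P
  baire (comeager O o d ⊆P) m =
    let
      start = shrunk m (B m) (let (x , x∈) = nonempty m in x , x∈ , x∈) (B-open m) 0
      seq = sequence (proj₁ start)
      T↓ = record { inhabited = λ k → nonempty (seq k) ; decreasing = λ k → proj₁ (stage k (seq k)) }
      (z , T→z) = limit id T↓ λ j →
        proj₁ (proj₂ (proj₂ (proj₂ (next j (seq j))))) , suc j ,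
        proj₂ (proj₂ (proj₂ (proj₂ (next j (seq j)))))
    in z , proj₁ (proj₂ (proj₂ start)) (limit-cl id T↓ T→z 0 id) ,
       ⊆P λ n → proj₂ (stage n (seq n)) (limit-cl id T↓ T→z (suc n) id)
    where
    shrunk : ∀ m (V : Pred Carrier 0ℓ) → (∃ λ x → x ∈ B m × x ∈ V) → IsOpen V → ∀ j →
             ∃ λ k → B k ⊆ B m × cl (B k) ⊆ V × ∃ λ i → B k ⊆ B (tile j i)
    shrunk m V (x , x∈m , x∈V) oV j =
      let
        (n , x∈n , n⊆V) = oV x∈V
        (k , x∈k , k⊆n) = regular x∈n
        (i , x∈i) = tile-cover j x
        (p , x∈p , p⊆m , p⊆k) = meet x∈m x∈k
        (q , x∈q , q⊆p , q⊆i) = meet x∈p x∈i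
      in q , p⊆m ∘ q⊆p ,
         (λ y∈ → n⊆V (k⊆n λ a y∈a → let (w , w∈a , w∈q) = y∈ a y∈a in w , w∈a , p⊆k (q⊆p w∈q))) ,
         i , q⊆i
    next : ∀ j m → ∃ λ k → B k ⊆ B m × cl (B k) ⊆ O j × ∃ λ i → B k ⊆ B (tile j i)
    next j m = shrunk m (O j) (d j m) (o j) j
    sequence : ℕ → ℕ → ℕ
    sequence m zero = m
    sequence m (suc k) = proj₁ (next k (sequence m k))
    stage : ∀ j m → B (proj₁ (next j m)) ⊆ B m × cl (B (proj₁ (next j m))) ⊆ O j
    stage j m = let (_ , ⊆m , ⊆O , _) = next j m in ⊆m , ⊆O

  baire-open : ∀ {ℓ ℓ′} {P : Pred Carrier ℓ} {V : Pred Carrier ℓ′} → Comeager P →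
               IsOpen V → ∃ V → ∃ λ x → x ∈ V × x ∈ P
  baire-open cP oV (x , x∈) =
    let (m , _ , m⊆) = oV x∈ ; (z , z∈m , z∈P) = baire cP m in z , m⊆ z∈m , z∈P

module _ {X Y : Setoid 0ℓ 0ℓ} (bX : PolishBase X) (bY : PolishBase Y) where
  private
    module X where
      open Setoid X public
      open PolishBase bX public
    module Y where
      open Setoid Y public
      open PolishBase bY public

  ContinuousOn : ∀ {ℓ} → Pred X.Carrier ℓ → (X.Carrier → Y.Carrier) → Set ℓ
  ContinuousOn C f = ∀ {x n} → x ∈ C → f x ∈ Y.B n →
    ∃ λ m → x ∈ X.B m × ∀ {z} → z ∈ X.B m → z ∈ C → f z ∈ Y.B n

  com-homeo : ∀ {ℓ} {P : Pred Y.Carrier ℓ} {f : X.Carrier → Y.Carrier} {g : Y.Carrier → X.Carrier} →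
    (∀ {V} → Y.IsOpen V → X.IsOpen (λ x → f x ∈ V)) →
    (∀ {V} → X.IsOpen V → Y.IsOpen (λ y → g y ∈ V)) →
    (∀ y → f (g y) Y.≈ y) → (∀ x → g (f x) X.≈ x) →
    Y.Comeager P → X.Comeager (λ x → f x ∈ P)
  com-homeo {f = f} {g} f-cont g-cont fg gf (Y.comeager O o d ⊆P) = X.comeager
    (λ n x → f x ∈ O n) (λ n → f-cont (o n))
    (λ n m →
      let (x , x∈) = X.nonempty m
          (k , _ , k⊆) = g-cont (X.B-open m) (X.B-resp m (X.sym (gf x)) x∈)
          (y , y∈k , y∈O) = d n k
      in g y , k⊆ y∈k , Y.open-resp (o n) (Y.sym (fg y)) y∈O)
    ⊆P

_×-base_ : ∀ {S S′} → Base S → Base S′ → Base (S × S′)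
bS ×-base bS′ = record
  { B = λ k → S.B (proj₁ (unpair k)) ⟨×⟩ S′.B (proj₂ (unpair k))
  ; nonempty = λ k → let (x , x∈) = S.nonempty _ ; (y , y∈) = S′.nonempty _
                     in (x , y) , x∈ , y∈
  ; cover = λ (x , y) →
      let (m , x∈) = S.cover x ; (n , y∈) = S′.cover y
      in rectangle (x∈ , y∈)
  ; meet = λ (x∈m , y∈m) (x∈n , y∈n) →
      let (a , x∈a , a⊆m , a⊆n) = S.meet x∈m x∈n
          (b , y∈b , b⊆m , b⊆n) = S′.meet y∈m y∈n
          (k , eq) = pair a b
      in k , subst (λ (a , b) → (S.B a ⟨×⟩ S′.B b) _) (≡.sym eq) (x∈a , y∈b) ,
         (λ z∈ → let (z∈a , z∈b) = subst (λ (a , b) → (S.B a ⟨×⟩ S′.B b) _) eq z∈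
                 in a⊆m z∈a , b⊆m z∈b) ,
         (λ z∈ → let (z∈a , z∈b) = subst (λ (a , b) → (S.B a ⟨×⟩ S′.B b) _) eq z∈
                 in a⊆n z∈a , b⊆n z∈b)
  }
  where
  module S = Base bS
  module S′ = Base bS′
  rectangle : ∀ {a b p} → p ∈ (S.B a ⟨×⟩ S′.B b) →
              ∃ λ k → p ∈ (S.B (proj₁ (unpair k)) ⟨×⟩ S′.B (proj₂ (unpair k)))
  rectangle {a} {b} p∈ = let (k , eq) = pair a b in
    k , subst (λ (a , b) → (S.B a ⟨×⟩ S′.B b) _) (≡.sym eq) p∈

module Product {S S′ : Set} (bS : Base S) (bS′ : Base S′) where
  private
    module S = Base bS
    module S′ = Base bS′
  open Base (bS ×-base bS′)

  box : ∀ a b → ∃ λ k → (S.B a ⟨×⟩ S′.B b) ⊆ B k × B k ⊆ (S.B a ⟨×⟩ S′.B b)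
  box a b = let (k , eq) = pair a b in
    k , (λ {p} → subst (λ (a , b) → p ∈ (S.B a ⟨×⟩ S′.B b)) (≡.sym eq)) ,
        (λ {p} → subst (λ (a , b) → p ∈ (S.B a ⟨×⟩ S′.B b)) eq)

  section-open : ∀ {V : Pred (S × S′) 0ℓ} → IsOpen V → ∀ y → S.IsOpen (λ x → (x , y) ∈ V)
  section-open oV y xy∈ = let (k , (x∈ , y∈) , k⊆) = oV xy∈ in _ , x∈ , λ z∈ → k⊆ (z∈ , y∈)

  -- The easy half of the Kuratowski–Ulam theorem.
  kernel : ∀ {ℓ} {P : Pred (S × S′) ℓ} → Comeager P → ℕ → ℕ → Pred S 0ℓ
  kernel cP n m x = ∃ λ y → y ∈ S′.B m × (x , y) ∈ Comeager.O cP n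

  module _ {ℓ} {P : Pred (S × S′) ℓ} (cP : Comeager P) where
    open Comeager cP

    kernel-open : ∀ n m → S.IsOpen (kernel cP n m)
    kernel-open n m (y , y∈ , xy∈) =
      let (a , x∈ , a⊆) = section-open (O-open n) y xy∈ in a , x∈ , λ z∈ → y , y∈ , a⊆ z∈

    kernel-dense : ∀ n m → S.IsDense (kernel cP n m)
    kernel-dense n m a =
      let (k , _ , k⊆) = box a m
          ((x , y) , xy∈k , xy∈O) = O-dense n k
          (x∈ , y∈) = k⊆ xy∈k
      in x , x∈ , y , y∈ , xy∈O

    kernel-sections : ∀ {x} → (∀ n m → x ∈ kernel cP n m) → S′.Comeager (λ y → (x , y) ∈ P)
    kernel-sections {x} x∈ = S′.comeager (λ n y → (x , y) ∈ O n)
      (λ n xy∈ → let (k , (x∈ , y∈) , k⊆) = O-open n xy∈ in _ , y∈ , λ z∈ → k⊆ (x∈ , z∈))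
      x∈ (λ y∈ → O⊆ y∈)

    kuratowski-ulam : S.Comeager (λ x → S′.Comeager (λ y → (x , y) ∈ P))
    kuratowski-ulam = S.com-mono kernel-sections
      (S.com-⋂ ℕ-enum λ n → S.com-⋂ ℕ-enum λ m → S.com-open (kernel-open n m) (kernel-dense n m))

record BaseGroup : Set₁ where
  field
    group  : Group 0ℓ 0ℓ
    polish : PolishBase (Group.setoid group)
  open Group group public
  open PolishBase polish public
  field
    ∙-cont  : ∀ {n g h} → g ∙ h ∈ B n → ∃ λ a → ∃ λ b → g ∈ B a × h ∈ B b ×
              ∀ {g′ h′} → g′ ∈ B a → h′ ∈ B b → g′ ∙ h′ ∈ B n
    ⁻¹-cont : ∀ {n g} → g ⁻¹ ∈ B n → ∃ λ a → g ∈ B a × ∀ {g′} → g′ ∈ B a → g′ ⁻¹ ∈ B n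

  ∙ʳ-open : ∀ h {V : Pred Carrier 0ℓ} → IsOpen V → IsOpen (λ g → g ∙ h ∈ V)
  ∙ʳ-open h oV gh∈ = let (n , gh∈n , n⊆) = oV gh∈
                         (a , _ , g∈ , h∈ , ab⊆) = ∙-cont gh∈n
                     in a , g∈ , λ z∈ → n⊆ (ab⊆ z∈ h∈)

  ∙ˡ-open : ∀ g {V : Pred Carrier 0ℓ} → IsOpen V → IsOpen (λ h → g ∙ h ∈ V)
  ∙ˡ-open g oV gh∈ = let (n , gh∈n , n⊆) = oV gh∈
                         (_ , b , g∈ , h∈ , ab⊆) = ∙-cont gh∈n
                     in b , h∈ , λ z∈ → n⊆ (ab⊆ g∈ z∈)

  ⁻¹-open : ∀ {V : Pred Carrier 0ℓ} → IsOpen V → IsOpen (λ g → g ⁻¹ ∈ V)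
  ⁻¹-open oV g∈ = let (n , g∈n , n⊆) = oV g∈
                      (a , g∈a , a⊆) = ⁻¹-cont g∈n
                  in a , g∈a , λ z∈ → n⊆ (a⊆ z∈)

  [gh]h⁻¹≈g : ∀ g h → g ∙ h ∙ h ⁻¹ ≈ g
  [gh]h⁻¹≈g g h = trans (assoc g h (h ⁻¹)) (trans (∙-congˡ (inverseʳ h)) (identityʳ g))

  [gh⁻¹]h≈g : ∀ g h → g ∙ h ⁻¹ ∙ h ≈ g
  [gh⁻¹]h≈g g h = trans (assoc g (h ⁻¹) h) (trans (∙-congˡ (inverseˡ h)) (identityʳ g))

  com-∙ʳ : ∀ {ℓ} {P : Pred Carrier ℓ} h → Comeager P → Comeager (λ g → g ∙ h ∈ P)
  com-∙ʳ h = com-homeo polish polish (∙ʳ-open h) (∙ʳ-open (h ⁻¹))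
    (λ g → [gh⁻¹]h≈g g h) (λ g → [gh]h⁻¹≈g g h)

  -- The right uniformity without a metric: for a compatible right-invariant d it says that d (s i)
  -- (s j) tends to 0.
  RightCauchyᴮ : (ℕ → Carrier) → Set
  RightCauchyᴮ s = ∀ {m} → ε ∈ B m → ∃ λ N → ∀ {i j} → N ℕ.≤ i → N ℕ.≤ j → s j ∙ s i ⁻¹ ∈ B m

record BaseSpace (G : BaseGroup) : Set₁ where
  infixr 8 _·_
  private module G = BaseGroup G
  field
    setoid : Setoid 0ℓ 0ℓ
    polish : PolishBase setoid
  open Setoid setoid public
  open PolishBase polish public
  field
    _·_        : G.Carrier → Carrier → Carrier
    ·-cong     : ∀ {g h x y} → g G.≈ h → x ≈ y → g · x ≈ h · y
    ·-identity : ∀ x → G.ε · x ≈ x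
    ·-assoc    : ∀ g h x → (g G.∙ h) · x ≈ g · h · x
    ·-cont     : ∀ {n g x} → g · x ∈ B n → ∃ λ a → ∃ λ b → g ∈ G.B a × x ∈ B b ×
                 ∀ {g′ x′} → g′ ∈ G.B a → x′ ∈ B b → g′ · x′ ∈ B n

  _∼_ : Carrier → Carrier → Set
  x ∼ y = ∃ λ g → g · x ≈ y

  g⁻¹gx≈x : ∀ g x → (g G.⁻¹) · g · x ≈ x
  g⁻¹gx≈x g x = trans (sym (·-assoc _ _ _)) (trans (·-cong (G.inverseˡ g) refl) (·-identity x))

  gg⁻¹x≈x : ∀ g x → g · (g G.⁻¹) · x ≈ x
  gg⁻¹x≈x g x = trans (sym (·-assoc _ _ _)) (trans (·-cong (G.inverseʳ g) refl) (·-identity x))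

  ∼-sym : ∀ {x y} → x ∼ y → y ∼ x
  ∼-sym {x} (g , gx≈y) = g G.⁻¹ , trans (·-cong G.refl (sym gx≈y)) (g⁻¹gx≈x g x)

  ∼-trans : ∀ {x y z} → x ∼ y → y ∼ z → x ∼ z
  ∼-trans {x} (g , gx≈y) (h , hy≈z) = h G.∙ g ,
    trans (·-assoc h g x) (trans (·-cong G.refl gx≈y) hy≈z)

  ·ˡ-open : ∀ g {V : Pred Carrier 0ℓ} → IsOpen V → IsOpen (λ x → g · x ∈ V)
  ·ˡ-open g oV gx∈ = let (n , gx∈n , n⊆) = oV gx∈
                         (_ , b , g∈ , x∈ , ab⊆) = ·-cont gx∈n
                     in b , x∈ , λ z∈ → n⊆ (ab⊆ g∈ z∈)

  ·ʳ-open : ∀ x {V : Pred Carrier 0ℓ} → IsOpen V → G.IsOpen (λ g → g · x ∈ V)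
  ·ʳ-open x oV gx∈ = let (n , gx∈n , n⊆) = oV gx∈
                         (a , _ , g∈ , x∈ , ab⊆) = ·-cont gx∈n
                     in a , g∈ , λ z∈ → n⊆ (ab⊆ z∈ x∈)

  open Product base G.base using (box; kuratowski-ulam) public
  module X×G = Base (base ×-base G.base)

  -- Each g acts as a homeomorphism, so density is achieved by moving x alone while g is kept.
  com-action : ∀ {ℓ} {P : Pred Carrier ℓ} → Comeager P → X×G.Comeager (λ (x , g) → g · x ∈ P)
  com-action (comeager O o d ⊆P) = X×G.comeager
    (λ n (x , g) → g · x ∈ O n)
    (λ n gx∈ →
      let (m , gx∈m , m⊆) = o n gx∈
          (a , b , g∈a , x∈b , ab⊆) = ·-cont gx∈m
          (k , ⊆k , k⊆) = box b a
      in k , ⊆k (x∈b , g∈a) , λ z∈ → let (x∈ , g∈) = k⊆ z∈ in m⊆ (ab⊆ g∈ x∈))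
    (λ n k →
      let ((x , g) , x∈ , g∈) = X×G.nonempty k
          (m , _ , m⊆) = ·ˡ-open (g G.⁻¹) (B-open _) (B-resp _ (sym (g⁻¹gx≈x g x)) x∈)
          (y , y∈m , y∈O) = d n m
      in ((g G.⁻¹) · y , g) , (m⊆ y∈m , g∈) , open-resp (o n) (sym (gg⁻¹x≈x g y)) y∈O)
    ⊆P

  com-orbit : ∀ {ℓ} {P : Pred Carrier ℓ} → Comeager P →
              Comeager (λ x → G.Comeager (λ g → g · x ∈ P))
  com-orbit cP = kuratowski-ulam (com-action cP)

  Embedsᴮ : Carrier → Carrier → Set
  Embedsᴮ x x′ = ∃ λ (s : ℕ → G.Carrier) → G.RightCauchyᴮ s ×
    ∀ {m} → x ∈ B m → ∃ λ N → ∀ {n} → N ℕ.≤ n → s n · x′ ∈ B m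

record NeighbourhoodBase {S : Set} (base : Base S) (x : S) : Set where
  open Base base
  field
    nb      : ℕ → ℕ
    ∈nb     : ∀ k → x ∈ B (nb k)
    nb-step : ∀ k → B (nb (suc k)) ⊆ B (nb k)
    nb-⊆    : ∀ {m} → x ∈ B m → ∃ λ k → B (nb k) ⊆ B m

  nb↓ : Shrinking (λ k → B (nb k))
  nb↓ = record { inhabited = λ k → x , ∈nb k ; decreasing = nb-step }

module Neighbourhoods (em : ∀ {ℓ} → ExcludedMiddle ℓ) {S : Set} (base : Base S) where
  open Base base

  -- `Rel` is any demand on successive neighbourhoods that persists under shrinking, such as halving
  -- in a group. Step k also enters `B k` whenever x is in it, which makes the chain a base at x.
  neighbourhoods : ∀ x {Rel : ℕ → ℕ → Set} →
    (∀ {m} → x ∈ B m → ∃ λ n → x ∈ B n × B n ⊆ B m × Rel m n) →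
    (∀ {m n k} → Rel m n → B k ⊆ B n → Rel m k) →
    ∃ λ (N : NeighbourhoodBase base x) →
      ∀ k → Rel (NeighbourhoodBase.nb N k) (NeighbourhoodBase.nb N (suc k))
  neighbourhoods x {Rel} refine anti = record
    { nb = λ k → proj₁ (seq k)
    ; ∈nb = λ k → proj₂ (seq k)
    ; nb-step = λ k → proj₁ (proj₂ (proj₂ (step k (seq k))))
    ; nb-⊆ = λ {m} x∈ → suc m , proj₁ (proj₂ (proj₂ (proj₂ (step m (seq m))))) x∈
    } , λ k → proj₂ (proj₂ (proj₂ (proj₂ (step k (seq k)))))
    where
    both : ∀ k {m} → x ∈ B m → ∃ λ n → x ∈ B n × B n ⊆ B m × (x ∈ B k → B n ⊆ B k)
    both k {m} x∈m with em {P = x ∈ B k}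
    ... | yes x∈k = let (n , x∈n , n⊆m , n⊆k) = meet x∈m x∈k in n , x∈n , n⊆m , λ _ → n⊆k
    ... | no x∉k = m , x∈m , id , λ x∈k → contradiction x∈k x∉k
    step : ∀ k (here : ∃ λ m → x ∈ B m) →
           ∃ λ n → x ∈ B n × B n ⊆ B (proj₁ here) × (x ∈ B k → B n ⊆ B k) × Rel (proj₁ here) n
    step k (m , x∈m) =
      let (n , x∈n , n⊆m , r) = refine x∈m
          (p , x∈p , p⊆n , p⊆k) = both k x∈n
      in p , x∈p , n⊆m ∘ p⊆n , p⊆k , anti r p⊆n
    seq : ℕ → ∃ λ m → x ∈ B m
    seq zero = cover x
    seq (suc k) = let (n , x∈n , _) = step k (seq k) in n , x∈n

-- Right embeddings along a generically continuous homomorphism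

dependent-choice : ∀ {a b} {A : ℕ → Set a} {R : ∀ k → A k → A (suc k) → Set b} →
                   A 0 → (∀ k x → ∃ (R k x)) →
                   ∃ λ (f : ∀ k → A k) → ∀ k → R k (f k) (f (suc k))
dependent-choice {A = A} start next = f , λ k → proj₂ (next k (f k))
  where
  f : ∀ k → A k
  f zero = start
  f (suc k) = proj₁ (next k (f k))

module PartialMap {X Y : Setoid 0ℓ 0ℓ} (bX : PolishBase X) (bY : PolishBase Y)
                  {C : Pred (Setoid.Carrier X) 0ℓ} {f : Setoid.Carrier X → Setoid.Carrier Y}
                  (f-cont : ContinuousOn bX bY C f) where
  private
    module X where
      open Setoid X public
      open PolishBase bX public
    module Y where
      open Setoid Y public
      open PolishBase bY public

  -- `ψ` will be chosen pointwise and may fail to be a congruence; continuity on `C` and T₀ supply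
  -- what is required of it.
  f-cong : ∀ {x x′} → x ∈ C → x′ ∈ C → x X.≈ x′ → f x Y.≈ f x′
  f-cong x∈ x′∈ x≈x′ = Y.T₀ λ m fx∈ →
    let (n , x∈n , n⊆) = f-cont x∈ fx∈ in n⊆ (X.B-resp n x≈x′ x∈n) x′∈

  module _ {R : Set} {π : R → X.Carrier} {T : ℕ → Pred R 0ℓ} (π∈C : ∀ r → π r ∈ C) where

    Limit-f : ∀ {x} → x ∈ C → X.Limit π T x → Y.Limit (f ∘ π) T (f x)
    Limit-f x∈C T→x fx∈ =
      let (n , x∈n , n⊆) = f-cont x∈C fx∈
          (k , T⊆) = T→x x∈n
      in k , λ r∈ → n⊆ (T⊆ r∈) (π∈C _)

module _ {X : Setoid 0ℓ 0ℓ} (bX : PolishBase X) where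
  open Setoid X
  open PolishBase bX

  module _ {R : Set} {T : ℕ → Pred R 0ℓ} (T↓ : Shrinking T) where

    limit-unique : ∀ {π ρ : R → Carrier} {x y} → (∀ r → π r ≈ ρ r) →
                   Limit π T x → Limit ρ T y → x ≈ y
    limit-unique π≈ρ T→x T→y = hausdorff λ {m} x∈m y∈n →
      let (k , ⊆m) = T→x x∈m
          (k′ , ⊆n) = T→y y∈n
          (r , r∈k , r∈k′) = Shrinking.common T↓ k k′
      in _ , B-resp m (π≈ρ r) (⊆m r∈k) , ⊆n r∈k′

    limit-≈ : ∀ {π : R → Carrier} {x y} → Limit π T x →
              (∀ k {m} → y ∈ B m → ∃ λ r → r ∈ T k × π r ∈ B m) → y ≈ x
    limit-≈ T→x near = hausdorff λ y∈m x∈n →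
      let (k , ⊆n) = T→x x∈n
          (r , r∈ , πr∈m) = near k y∈m
      in _ , πr∈m , ⊆n r∈

module _ {G : BaseGroup} (X : BaseSpace G) where
  private module G = BaseGroup G
  open BaseSpace X

  Limit-· : ∀ {R : Set} {γ : R → G.Carrier} {π : R → Carrier} {T g x} → Shrinking T →
            G.Limit γ T g → Limit π T x → Limit (λ r → γ r · π r) T (g · x)
  Limit-· T↓ T→g T→x gx∈ =
    let (a , b , g∈ , x∈ , ab⊆) = ·-cont gx∈
        (k , ⊆a) = T→g g∈
        (n , ⊆b) = T→x x∈
    in k ℕ.⊔ n , λ r∈ → ab⊆ (⊆a (decreasing-≤ (ℕ.m≤m⊔n k n) r∈)) (⊆b (decreasing-≤ (ℕ.m≤n⊔m k n) r∈))
    where open Shrinking T↓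

module Embedding (em : ∀ {ℓ} → ExcludedMiddle ℓ) {G H : BaseGroup}
                 (X : BaseSpace G) (Y : BaseSpace H)
                 (C : ℕ → Pred (BaseSpace.Carrier X) 0ℓ)
                 (C-open : ∀ n → BaseSpace.IsOpen X (C n))
                 (f : BaseSpace.Carrier X → BaseSpace.Carrier Y)
                 (f-cont : ContinuousOn (BaseSpace.polish X) (BaseSpace.polish Y) (⋂ ℕ C) f)
                 (f-hom : ∀ {x} g → x ∈ ⋂ ℕ C → BaseSpace._·_ X g x ∈ ⋂ ℕ C →
                   ∃ λ h → BaseSpace._≈_ Y (BaseSpace._·_ Y h (f x)) (f (BaseSpace._·_ X g x)))
                 where
  private
    module G = BaseGroup G
    module H = BaseGroup H
    module X = BaseSpace X
    module Y = BaseSpace Y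
  open X using (_·_; module X×G; box)
  open Y using () renaming (_·_ to _∗_)
  open Choice em
  open PartialMap X.polish Y.polish f-cont

  InC : Pred X.Carrier 0ℓ
  InC = ⋂ ℕ C

  InC-resp : ∀ {x y} → x X.≈ y → x ∈ InC → y ∈ InC
  InC-resp x≈y x∈ n = X.open-resp (C-open n) x≈y (x∈ n)

  Moves : ℕ → Pred (X.Carrier × G.Carrier) 0ℓ
  Moves l (x , g) = ∃ λ w → w ∈ H.B l × x ∈ InC × g · x ∈ InC × f (g · x) Y.≈ w ∗ f x

  record Move (l : ℕ) : Set where
    field
      x     : X.Carrier
      g     : G.Carrier
      moves : (x , g) ∈ Moves l
    w : H.Carrier
    w = proj₁ moves

  module _ (l : ℕ) where
    open Move

    Index : Set
    Index = (ℕ ⊎ (ℕ ⊎ ℕ)) ⊎ (ℕ ⊎ (ℕ ⊎ ℕ))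

    index : Enumeration Index
    index = three ⊎-enum three
      where three = ℕ-enum ⊎-enum (ℕ-enum ⊎-enum ℕ-enum)

    -- Tiles make x, g and w converge along a branch; the other covers keep the limits of x and g ·
    -- x in every `C n` and that of w in `H.B l`. As f is continuous on `InC`, the limit is again a
    -- move.
    pieces : Index → ℕ → Pred (Move l) 0ℓ
    pieces (inj₁ (inj₁ j))        = X.tiles x j
    pieces (inj₁ (inj₂ (inj₁ j))) = G.tiles g j
    pieces (inj₁ (inj₂ (inj₂ j))) = H.tiles w j
    pieces (inj₂ (inj₁ n))        = X.inside x (C n)
    pieces (inj₂ (inj₂ (inj₁ n))) = X.inside (λ r → g r · x r) (C n)
    pieces (inj₂ (inj₂ (inj₂ _))) = H.inside w (H.B l)

    pieces-cover : ∀ j r → ∃ λ i → r ∈ pieces j i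
    pieces-cover (inj₁ (inj₁ j))        r = X.tiles-cover x j r
    pieces-cover (inj₁ (inj₂ (inj₁ j))) r = G.tiles-cover g j r
    pieces-cover (inj₁ (inj₂ (inj₂ j))) r = H.tiles-cover w j r
    pieces-cover (inj₂ (inj₁ n)) r =
      X.inside-cover x {C n} (C-open n) {r} (proj₁ (proj₂ (proj₂ (moves r))) n)
    pieces-cover (inj₂ (inj₂ (inj₁ n))) r =
      X.inside-cover (λ r → g r · x r) {C n} (C-open n) {r} (proj₁ (proj₂ (proj₂ (proj₂ (moves r)))) n)
    pieces-cover (inj₂ (inj₂ (inj₂ _))) r =
      H.inside-cover w {H.B l} (H.B-open l) {r} (proj₁ (proj₂ (moves r)))

    module S = Souslin em (X.base ×-base G.base) index pieces pieces-cover (λ r → x r , g r)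

    -- The branch of p yields a limiting move, and since its pieces accumulate at p, the pair (x₀,
    -- g₀) of that move is p up to `≈`. With the last clause of `Typical`, this gives `Moves l` the
    -- Baire property.
    hull⊆Moves : ∀ {p} → p ∈ S.H [] → p ∈ S.Typical → p ∈ Moves l
    hull⊆Moves {x₁ , g₁} p∈H p-typical =
      w₀ , H.limit-inside w T↓ T→w (T-fine (inj₂ (inj₂ (inj₂ 0)))) ,
      x₁∈C , gx₁∈C ,
      Y.trans (f-cong {g₁ · x₁} {g₀ · x₀} gx₁∈C gx₀∈C gx₁≈gx₀)
        (Y.trans f≈ (Y.·-cong H.refl (Y.sym (f-cong {x₁} {x₀} x₁∈C x₀∈C x₁≈x₀))))
      where
      T : ℕ → Pred (Move l) 0ℓ
      T = S.Pieces p∈H p-typical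
      T↓ : Shrinking T
      T↓ = record
        { inhabited = λ k → let (m , p∈m) = X×G.cover (x₁ , g₁)
                                (r , r∈ , _) = S.pieces-cl p∈H p-typical k m p∈m
                            in r , r∈
        ; decreasing = S.pieces-decreasing p∈H p-typical }
      T-fine : ∀ j → ∃ λ i → ∃ λ k → T k ⊆ pieces j i
      T-fine = S.pieces-fine p∈H p-typical
      lim-x = X.limit x T↓ (λ j → T-fine (inj₁ (inj₁ j)))
      lim-g = G.limit g T↓ (λ j → T-fine (inj₁ (inj₂ (inj₁ j))))
      lim-w = H.limit w T↓ (λ j → T-fine (inj₁ (inj₂ (inj₂ j))))
      x₀ = proj₁ lim-x
      T→x = proj₂ lim-x
      g₀ = proj₁ lim-g
      T→g = proj₂ lim-g
      w₀ = proj₁ lim-w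
      T→w : H.Limit w T w₀
      T→w = proj₂ lim-w
      T→gx : X.Limit (λ r → g r · x r) T (g₀ · x₀)
      T→gx = Limit-· X T↓ T→g T→x
      x₀∈C : x₀ ∈ InC
      x₀∈C n = X.limit-inside x T↓ T→x (T-fine (inj₂ (inj₁ n)))
      gx₀∈C : g₀ · x₀ ∈ InC
      gx₀∈C n = X.limit-inside _ T↓ T→gx (T-fine (inj₂ (inj₂ (inj₁ n))))
      f≈ : f (g₀ · x₀) Y.≈ w₀ ∗ f x₀
      f≈ = limit-unique Y.polish T↓ (λ r → proj₂ (proj₂ (proj₂ (proj₂ (moves r)))))
             (Limit-f (λ r → proj₁ (proj₂ (proj₂ (proj₂ (moves r))))) gx₀∈C T→gx)
             (Limit-· Y T↓ T→w (Limit-f (λ r → proj₁ (proj₂ (proj₂ (moves r)))) x₀∈C T→x))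
      x₁≈x₀ : x₁ X.≈ x₀
      x₁≈x₀ = limit-≈ X.polish T↓ T→x λ k x∈m →
        let (n , g∈n) = G.cover g₁
            (b , ⊆b , b⊆) = box _ n
            (r , r∈ , p∈) = S.pieces-cl p∈H p-typical k b (⊆b (x∈m , g∈n))
        in r , r∈ , proj₁ (b⊆ p∈)
      g₁≈g₀ : g₁ G.≈ g₀
      g₁≈g₀ = limit-≈ G.polish T↓ T→g λ k g∈m →
        let (n , x∈n) = X.cover x₁
            (b , ⊆b , b⊆) = box n _
            (r , r∈ , p∈) = S.pieces-cl p∈H p-typical k b (⊆b (x∈n , g∈m))
        in r , r∈ , proj₂ (b⊆ p∈)
      gx₁≈gx₀ : g₁ · x₁ X.≈ g₀ · x₀
      gx₁≈gx₀ = X.·-cong g₁≈g₀ x₁≈x₀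
      x₁∈C : x₁ ∈ InC
      x₁∈C = InC-resp (X.sym x₁≈x₀) x₀∈C
      gx₁∈C : g₁ · x₁ ∈ InC
      gx₁∈C = InC-resp (X.sym gx₁≈gx₀) gx₀∈C

  𝒰 : ℕ → Pred (X.Carrier × G.Carrier) 0ℓ
  𝒰 l = S.H l []

  𝒰-open : ∀ l → X×G.IsOpen (𝒰 l)
  𝒰-open l = Category.hull-open em (X.base ×-base G.base) (S.image l [])

  Coded : Pred (X.Carrier × G.Carrier) 0ℓ
  Coded p = ∀ l → (p ∈ Moves l → p ∈ 𝒰 l) × (p ∈ 𝒰 l → p ∈ Moves l)

  coded : X×G.Comeager Coded
  coded = X×G.com-⋂ ℕ-enum λ l → X×G.com-mono
    (λ {p} ty → (λ mv → proj₂ (proj₂ ty) (record { moves = mv }) ≡.refl) , λ p∈ → hull⊆Moves l p∈ ty)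
    (S.typical l)

  CodedAt : Pred X.Carrier (Level.suc 0ℓ)
  CodedAt x = G.Comeager (λ g → (x , g) ∈ Coded)

  DenseNear : ℕ → ℕ → Pred X.Carrier 0ℓ
  DenseNear l m x = ∀ n → G.B n ⊆ G.B m → ∃ λ g → g ∈ G.B n × (x , g) ∈ 𝒰 l

  Small𝒰 : ℕ → Pred X.Carrier 0ℓ
  Small𝒰 l x = (x , G.ε) ∈ 𝒰 l

  Small𝒰-open : ∀ l → X.IsOpen (Small𝒰 l)
  Small𝒰-open l = Product.section-open X.base G.base (𝒰-open l) G.ε

  -- If 𝒰 l is dense in {x} × B m for densely many x ∈ B a, it contains B a × B m,
  -- being regular open.
  dense⇒small : ∀ l m → X.Comeager (λ x → G.ε ∈ G.B m → x ∈ DenseNear l m → x ∈ Small𝒰 l)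
  dense⇒small l m with em {P = G.ε ∈ G.B m}
  ... | no ε∉ = X.com-always λ _ ε∈ → contradiction ε∈ ε∉
  ... | yes ε∈ = X.com-mono
    (λ (a , x∈a , a∩Z) _ dense → by-contradiction λ x∉ → a∩Z x∈a (dense , x∉))
    (X.com-open (X.ext-open Z) Z-nowhere-dense)
    where
    Z : Pred X.Carrier 0ℓ
    Z x = x ∈ DenseNear l m × x ∉ Small𝒰 l
    Z-nowhere-dense : X.IsDense (X.ext Z)
    Z-nowhere-dense a = by-contradiction λ none →
      let
        meets : ∀ {b x} → x ∈ X.B a → x ∈ X.B b → ∃ λ z → z ∈ X.B b × z ∈ Z
        meets {b} x∈a x∈b = by-contradiction λ b∩Z → none
          (_ , x∈a , b , x∈b , λ {z} z∈b z∈Z → b∩Z (z , z∈b , z∈Z))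
        (k , ⊆k , k⊆) = box a m
        k⊆𝒰 : X×G.B k ⊆ 𝒰 l
        k⊆𝒰 = Category.hull-regular em (X.base ×-base G.base) (S.image l []) k λ n n⊆k →
          let
            ((x , g) , x∈ , g∈) = X×G.nonempty n
            (x∈a , _) = k⊆ (n⊆k (x∈ , g∈))
            (z , z∈ , z-dense , _) = meets x∈a x∈
            (g′ , g′∈ , zg′∈) = z-dense _ λ h∈ → proj₂ (k⊆ (n⊆k (x∈ , h∈)))
          in (z , g′) , (z∈ , g′∈) , zg′∈
        (x , x∈a) = X.nonempty a
        (z , z∈a , _ , z∉) = meets x∈a x∈a
      in z∉ (k⊆𝒰 (⊆k (z∈a , ε∈)))

  Regular : Pred X.Carrier (Level.suc 0ℓ)
  Regular x = x ∈ CodedAt ×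
    (∀ l → x ∈ Small𝒰 l ∪ X.ext (Small𝒰 l)) ×
    (∀ l m → G.ε ∈ G.B m → x ∈ DenseNear l m → x ∈ Small𝒰 l)

  regular-comeager : X.Comeager Regular
  regular-comeager = X.com-∩ (X.kuratowski-ulam coded)
    (X.com-∩ (X.com-⋂ ℕ-enum λ l → Category.decide-ext em X.base (Small𝒰-open l))
             (X.com-⋂ ℕ-enum λ l → X.com-⋂ ℕ-enum λ m → dense⇒small l m))

  Good : Pred X.Carrier (Level.suc 0ℓ)
  Good x = x ∈ Regular × G.Comeager (λ g → g · x ∈ Regular)

  good : X.Comeager Good
  good = X.com-∩ regular-comeager (X.com-orbit regular-comeager)

  -- For generic q near `G.ε`, the point f x is moved to f (q g x) by some w close to h. The
  -- quotient w h⁻¹ is then close to `H.ε` and moves f (g x) to f (q g x).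
  dense-near : ∀ {x g l h} → (x , g) ∈ Coded → x ∈ CodedAt → g · x ∈ CodedAt →
               x ∈ InC → g · x ∈ InC → h ∗ f x Y.≈ f (g · x) → H.ε ∈ H.B l →
               ∃ λ m → G.ε ∈ G.B m × g · x ∈ DenseNear l m
  dense-near {x} {g} {l} {h} xg-coded x-coded gx-coded x∈C gx∈C hfx≈ ε∈l =
    let
      (a , b , h∈a , h⁻¹∈b , ab⊆l) =
        H.∙-cont {h = h H.⁻¹} (H.B-resp l (H.sym (H.inverseʳ h)) ε∈l)
      (b′ , h∈b′ , b′⊆) = H.⁻¹-cont h⁻¹∈b
      (l′ , h∈l′ , l′⊆a , l′⊆b′) = H.meet h∈a h∈b′
      ll′⁻¹⊆l : ∀ {u v} → u ∈ H.B l′ → v ∈ H.B l′ → u H.∙ v H.⁻¹ ∈ H.B l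
      ll′⁻¹⊆l u∈ v∈ = ab⊆l (l′⊆a u∈) (b′⊆ (l′⊆b′ v∈))
      (k , (x∈ , g∈) , k⊆) = 𝒰-open l′ (proj₁ (xg-coded l′) (h , h∈l′ , x∈C , gx∈C , Y.sym hfx≈))
      (m , ε∈m , m⊆) = G.∙ʳ-open g (G.B-open _) (G.B-resp _ (G.sym (G.identityˡ g)) g∈)
    in m , ε∈m , λ n n⊆m →
      let
        (q , q∈n , q-coded , qg-coded) = G.baire (G.com-∩ gx-coded (G.com-∙ʳ g x-coded)) n
        (w , w∈l′ , _ , qgx∈C , f≈) = proj₂ (qg-coded l′) (k⊆ (x∈ , m⊆ (n⊆m q∈n)))
        q·gx∈C = InC-resp (X.·-assoc q g x) qgx∈C
      in q , q∈n , proj₁ (q-coded l) (w H.∙ h H.⁻¹ , ll′⁻¹⊆l w∈l′ h∈l′ , gx∈C , q·gx∈C ,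
        Y.trans (f-cong {q · g · x} {(q G.∙ g) · x} q·gx∈C qgx∈C (X.sym (X.·-assoc q g x))) (Y.trans f≈
          (Y.trans (Y.·-cong (H.sym (H.[gh⁻¹]h≈g w h)) Y.refl) (Y.trans (Y.·-assoc _ h _)
            (Y.·-cong H.refl hfx≈)))))

  -- Otherwise a whole neighbourhood of x avoids `Small𝒰 l`. But a translate of x by a generic g
  -- near `G.ε` stays in that neighbourhood, and it belongs to `Small𝒰 l` by `dense-near` and its
  -- own regularity.
  small-everywhere : ∀ {x l} → x ∈ Good → x ∈ InC → G.Comeager (λ g → g · x ∈ InC) →
                     H.ε ∈ H.B l → x ∈ Small𝒰 l
  small-everywhere {x} {l} ((x-coded , split , _) , orbit) x∈C orbit∈C ε∈l
    with split l
  ... | inj₁ x∈ = x∈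
  ... | inj₂ (a , x∈a , a-avoids) =
    let
      (g , gx∈a , gx∈C , xg-coded , gx-coded , _ , gx-small) =
        G.baire-open (G.com-∩ orbit∈C (G.com-∩ x-coded orbit))
          (X.·ʳ-open x (X.B-open a)) (G.ε , X.B-resp a (X.sym (X.·-identity x)) x∈a)
      (h , hfx≈) = f-hom g x∈C gx∈C
      (m , ε∈m , gx-dense) = dense-near xg-coded x-coded gx-coded x∈C gx∈C hfx≈ ε∈l
    in contradiction (gx-small l m ε∈m gx-dense) (a-avoids gx∈a)

  module _ {x x′} (x-good : x ∈ Good) (x∈C : x ∈ InC) (x-orbit : G.Comeager (λ g → g · x ∈ InC))
           (x′-good : x′ ∈ Good) (x′∈C : x′ ∈ InC) (x′-orbit : G.Comeager (λ g → g · x′ ∈ InC))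
           where

    private
      -- A trivially inhabited relation: only a neighbourhood base at x is wanted here.
      X-base = Neighbourhoods.neighbourhoods em X.base x {λ _ _ → H.Carrier}
                 (λ {m} x∈ → m , x∈ , id , H.ε) (λ h _ → h)
      module β = NeighbourhoodBase (proj₁ X-base)

      Halves : ℕ → ℕ → Set
      Halves m n = ∀ {u v} → u ∈ H.B n → v ∈ H.B n → u H.∙ v ∈ H.B m

      halve : ∀ {m} → H.ε ∈ H.B m → ∃ λ n → H.ε ∈ H.B n × H.B n ⊆ H.B m × Halves m n
      halve {m} ε∈ =
        let (a , b , ε∈a , ε∈b , ab⊆) = H.∙-cont (H.B-resp m (H.sym (H.identityˡ H.ε)) ε∈)
            (n , ε∈n , n⊆a , n⊆b) = H.meet ε∈a ε∈b
            (p , ε∈p , p⊆n , p⊆m) = H.meet ε∈n ε∈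
        in p , ε∈p , p⊆m , λ u∈ v∈ → ab⊆ (n⊆a (p⊆n u∈)) (n⊆b (p⊆n v∈))

      H-base = Neighbourhoods.neighbourhoods em H.base H.ε {Halves} halve
                 (λ halves k⊆n u∈ v∈ → halves (k⊆n u∈) (k⊆n v∈))
      module W = NeighbourhoodBase (proj₁ H-base)
      W-halves = proj₂ H-base

      cell-at : ∀ k → ∃ λ c → (x , G.ε) ∈ X×G.B c × X×G.B c ⊆ 𝒰 (W.nb k)
      cell-at k = 𝒰-open (W.nb k) (small-everywhere x-good x∈C x-orbit (W.∈nb k))

      a m : ℕ → ℕ
      a k = proj₁ (unpair (proj₁ (cell-at k)))
      m k = proj₂ (unpair (proj₁ (cell-at k)))

    -- The tail condition leaves room to choose the next h with h ∙ hₖ⁻¹ ∈ B (m k),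
    -- generically and arbitrarily far along s.
    record Stage (k : ℕ) (s : ℕ → G.Carrier) (h : G.Carrier) : Set₁ where
      field
        h-coded : h · x′ ∈ CodedAt
        h∈C     : h · x′ ∈ InC
        h∈a     : h · x′ ∈ X.B (a k)
        h∈β     : h · x′ ∈ X.B (β.nb k)
        start   : ℕ
        tail    : ∀ {i} → start ℕ.≤ i → s i G.∙ h G.⁻¹ ∈ G.B (m k)

    State : (ℕ → G.Carrier) → ℕ → Set₁
    State s k = Σ G.Carrier (Stage k s)

    Step : ∀ s k → State s k → State s (suc k) → Set
    Step s k (h , _) (h′ , _) =
      ∃ λ w → w ∈ H.B (W.nb k) × f (h′ · x′) Y.≈ w ∗ f (h · x′)

    module _ (s : ℕ → G.Carrier) (s-cauchy : G.RightCauchyᴮ s)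
             (s-limit : ∀ {m} → x ∈ X.B m → ∃ λ N → ∀ {n} → N ℕ.≤ n → s n · x′ ∈ X.B m) where

      find : ∀ k {V : Pred G.Carrier 0ℓ} {ℓ} {P : Pred G.Carrier ℓ} → G.IsOpen V → ∀ N →
             (∀ {n} → N ℕ.≤ n → s n ∈ V) → G.Comeager P →
             ∃ λ h → Stage k s h × h ∈ V × h ∈ P
      find k {V} oV N s∈V cP =
        let
          (_ , (x∈a , ε∈m) , _) = cell-at k
          -- `G.B p` will absorb s i ∙ (s n)⁻¹ and `G.B q` will absorb s n ∙ h⁻¹; their product
          -- gives the tail condition.
          (p , q , ε∈p , ε∈q , pq⊆) = G.∙-cont (G.B-resp (m k) (G.sym (G.identityˡ G.ε)) ε∈m)
          (N₁ , close) = s-cauchy ε∈p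
          (N₂ , near-a) = s-limit x∈a
          (N₃ , near-β) = s-limit (β.∈nb k)
          n = N ℕ.⊔ N₁ ℕ.⊔ (N₂ ℕ.⊔ N₃)
          N⊔N₁≤n = ℕ.m≤m⊔n (N ℕ.⊔ N₁) (N₂ ℕ.⊔ N₃)
          N₂⊔N₃≤n = ℕ.m≤n⊔m (N ℕ.⊔ N₁) (N₂ ℕ.⊔ N₃)
          N₁≤n = ℕ.≤-trans (ℕ.m≤n⊔m N N₁) N⊔N₁≤n
          (h , (h∈V , h∈a , h∈β , h∈q) , (h-regular , h∈C , h∈P)) = G.baire-open
            (G.com-∩ (proj₂ x′-good) (G.com-∩ x′-orbit cP))
            (G.∩-open oV (G.∩-open (X.·ʳ-open x′ (X.B-open (a k)))
              (G.∩-open (X.·ʳ-open x′ (X.B-open (β.nb k)))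
                        (G.⁻¹-open (G.∙ˡ-open (s n) (G.B-open q))))))
            (s n , s∈V (ℕ.≤-trans (ℕ.m≤m⊔n N N₁) N⊔N₁≤n) ,
                   near-a (ℕ.≤-trans (ℕ.m≤m⊔n N₂ N₃) N₂⊔N₃≤n) ,
                   near-β (ℕ.≤-trans (ℕ.m≤n⊔m N₂ N₃) N₂⊔N₃≤n) ,
                   G.B-resp q (G.sym (G.inverseʳ (s n))) ε∈q)
        in h , record
          { h-coded = proj₁ h-regular ; h∈C = h∈C ; h∈a = h∈a ; h∈β = h∈β ; start = n
          ; tail = λ {i} n≤i → G.B-resp (m k) (telescope (s i) (s n) h)
              (pq⊆ (close N₁≤n (ℕ.≤-trans N₁≤n n≤i)) h∈q)
          } , h∈V , h∈P
        where
        telescope : ∀ u v h → (u G.∙ v G.⁻¹) G.∙ (v G.∙ h G.⁻¹) G.≈ u G.∙ h G.⁻¹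
        telescope u v h = G.trans (G.sym (G.assoc _ v (h G.⁻¹))) (G.∙-congʳ (G.[gh⁻¹]h≈g u v))

      initial : State s 0
      initial =
        let (h , stage , _) = find 0 G.U-open 0 _ (G.com-always {P = λ _ → H.Carrier} λ _ → H.ε)
        in h , stage

      advance : ∀ k σ → ∃ (Step s k σ)
      advance k (h , stage) =
        let
          open Stage stage
          -- By `tail`, the open condition h′ ∙ h⁻¹ ∈ `G.B (m k)` holds for late members of s. With
          -- it, (h · x′, h′ ∙ h⁻¹) lies in the box inside `𝒰 (W.nb k)`.
          (h′ , stage′ , h′∈ , coded′) = find (suc k) (G.∙ʳ-open (h G.⁻¹) (G.B-open (m k)))
            start tail (G.com-∙ʳ (h G.⁻¹) h-coded)
          (_ , _ , c⊆𝒰) = cell-at k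
          (w , w∈ , _ , h″∈C , f≈) = proj₂ (coded′ (W.nb k)) (c⊆𝒰 (h∈a , h′∈))
          h″≈h′ = X.trans (X.sym (X.·-assoc _ h x′)) (X.·-cong (G.[gh⁻¹]h≈g h′ h) X.refl)
        in (h′ , stage′) , w , w∈ ,
           Y.trans (f-cong {h′ · x′} {(h′ G.∙ h G.⁻¹) · h · x′} (Stage.h∈C stage′) h″∈C (X.sym h″≈h′)) f≈

    module Following (s : ℕ → G.Carrier) (states : ∀ k → State s k)
                     (steps : ∀ k → Step s k (states k) (states (suc k))) where

      h : ℕ → G.Carrier
      h k = proj₁ (states k)

      w : ℕ → H.Carrier
      w k = proj₁ (steps k)

      first : ∃ λ t → t ∗ f x′ Y.≈ f (h 0 · x′)
      first = f-hom (h 0) x′∈C (Stage.h∈C (proj₂ (states 0)))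

      t : ℕ → H.Carrier
      t zero = proj₁ first
      t (suc k) = w k H.∙ t k

      t-moves : ∀ k → f (h k · x′) Y.≈ t k ∗ f x′
      t-moves zero = Y.sym (proj₂ first)
      t-moves (suc k) = Y.trans (proj₂ (proj₂ (steps k)))
        (Y.trans (Y.·-cong H.refl (t-moves k)) (Y.sym (Y.·-assoc _ _ _)))

      -- For d > 0 the quotient is the product of the w i from i = d + k down to k + 1. Its last
      -- factor is in `W.nb (suc k)`, the product of the others is too by induction, and
      -- `W.nb (suc k)` squared is inside `W.nb k`. Starting at `suc k` leaves room for this
      -- halving.
      t-close : ∀ d k → t (d + suc k) H.∙ t (suc k) H.⁻¹ ∈ H.B (W.nb k)
      t-close zero k = H.B-resp (W.nb k) (H.sym (H.inverseʳ (t (suc k)))) (W.∈nb k)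
      t-close (suc d) k =
        subst (λ n → t n H.∙ t (suc k) H.⁻¹ ∈ H.B (W.nb k)) (ℕ.+-suc d (suc k))
          (H.B-resp (W.nb k) (eq (t (d + suc (suc k))) (w (suc k)) (t (suc k)))
            (W-halves k (t-close d (suc k)) (proj₁ (proj₂ (steps (suc k))))))
        where
        eq : ∀ u w t → (u H.∙ (w H.∙ t) H.⁻¹) H.∙ w H.≈ u H.∙ t H.⁻¹
        eq u w t = H.trans (H.∙-congˡ (H.sym (H.[gh]h⁻¹≈g w t)))
          (H.trans (H.sym (H.assoc _ (w H.∙ t) (t H.⁻¹))) (H.∙-congʳ (H.[gh⁻¹]h≈g u (w H.∙ t))))

      t-close-≤ : ∀ {i j k} → suc k ℕ.≤ i → i ℕ.≤ j → t j H.∙ t i H.⁻¹ ∈ H.B (W.nb k)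
      t-close-≤ {suc i} {j} {k} (ℕ.s≤s k≤i) i≤j =
        Shrinking.decreasing-≤ W.nb↓ k≤i
          (subst (λ j → t j H.∙ t (suc i) H.⁻¹ ∈ H.B (W.nb i)) (ℕ.m∸n+n≡m i≤j)
            (t-close (j ℕ.∸ suc i) i))

      t-cauchy : H.RightCauchyᴮ t
      t-cauchy {m} ε∈m =
        let
          (n , ε∈n , n⊆) = H.⁻¹-cont (H.B-resp m (H.sym ε⁻¹≈ε) ε∈m)
          (p , ε∈p , p⊆m , p⊆n) = H.meet ε∈m ε∈n
          (k , k⊆p) = W.nb-⊆ ε∈p
        in suc k , λ {i} {j} k<i k<j →
          [ (λ i≤j → p⊆m (k⊆p (t-close-≤ k<i i≤j)))
          , (λ j≤i → H.B-resp m (flip (t i) (t j)) (n⊆ (p⊆n (k⊆p (t-close-≤ k<j j≤i))))) ]′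
            (ℕ.≤-total i j)
        where
        open import Algebra.Properties.Group H.group using (⁻¹-anti-homo-∙; ε⁻¹≈ε; ⁻¹-involutive)
        flip : ∀ u v → (u H.∙ v H.⁻¹) H.⁻¹ H.≈ v H.∙ u H.⁻¹
        flip u v = H.trans (⁻¹-anti-homo-∙ u (v H.⁻¹)) (H.∙-congʳ (⁻¹-involutive v))

      t-limit : ∀ {m} → f x ∈ Y.B m → ∃ λ N → ∀ {n} → N ℕ.≤ n → t n ∗ f x′ ∈ Y.B m
      t-limit {m} fx∈ =
        let
          (n , x∈n , n⊆) = f-cont x∈C fx∈
          (k , k⊆n) = β.nb-⊆ x∈n
        in k , λ {i} k≤i → let open Stage (proj₂ (states i)) in
          Y.B-resp m (t-moves i) (n⊆ (k⊆n (Shrinking.decreasing-≤ β.nb↓ k≤i h∈β)) h∈C)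

    embeds : X.Embedsᴮ x x′ → Y.Embedsᴮ (f x) (f x′)
    embeds (s , s-cauchy , s-limit) =
      let (states , steps) = dependent-choice (initial s s-cauchy s-limit) (advance s s-cauchy s-limit)
          open Following s states steps
      in t , t-cauchy , t-limit

-- The saturation of the continuous image f(C) agrees with an open set up to
-- a meager set, and has a generically continuous section.
module Section (em : ∀ {ℓ} → ExcludedMiddle ℓ) {H : BaseGroup} {X : Setoid 0ℓ 0ℓ}
               (bX : PolishBase X) (Y : BaseSpace H)
               (C : ℕ → Pred (Setoid.Carrier X) 0ℓ)
               (C-open : ∀ n → PolishBase.IsOpen bX (C n))
               (f : Setoid.Carrier X → BaseSpace.Carrier Y)
               (f-cont : ContinuousOn bX (BaseSpace.polish Y) (⋂ ℕ C) f)
               (default : Setoid.Carrier X) where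
  private
    module H = BaseGroup H
    module X where
      open Setoid X public
      open PolishBase bX public
    module Y = BaseSpace Y
  open Y using () renaming (_·_ to _∗_)
  open PartialMap bX Y.polish f-cont

  Saturation : Pred Y.Carrier 0ℓ
  Saturation y = ∃ λ h → ∃ λ x → x ∈ ⋂ ℕ C × h ∗ f x Y.≈ y

  record Point : Set where
    field
      h   : H.Carrier
      x   : X.Carrier
      x∈C : x ∈ ⋂ ℕ C
  open Point

  pieces : ℕ ⊎ (ℕ ⊎ ℕ) → ℕ → Pred Point 0ℓ
  pieces (inj₁ j)        = X.tiles x j
  pieces (inj₂ (inj₁ j)) = H.tiles h j
  pieces (inj₂ (inj₂ n)) = X.inside x (C n)

  pieces-cover : ∀ j r → ∃ λ i → r ∈ pieces j i
  pieces-cover (inj₁ j)        r = X.tiles-cover x j r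
  pieces-cover (inj₂ (inj₁ j)) r = H.tiles-cover h j r
  pieces-cover (inj₂ (inj₂ n)) r = X.inside-cover x {C n} (C-open n) {r} (x∈C r n)

  module S = Souslin em Y.base (ℕ-enum ⊎-enum (ℕ-enum ⊎-enum ℕ-enum)) pieces pieces-cover
                     (λ r → h r ∗ f (x r))
  open Y.Comeager S.typical

  -- The hull of the saturation, cut down by the dense open sets witnessing typicality: a Gδ set
  -- comeager in the hull, though in general not in Y.
  D : ℕ → Pred Y.Carrier 0ℓ
  D zero    = S.H []
  D (suc n) = O n

  D-open : ∀ n → Y.IsOpen (D n)
  D-open zero    = Category.hull-open em Y.base (S.image [])
  D-open (suc n) = O-open n

  D⇒typical : ∀ {y} → y ∈ ⋂ ℕ D → y ∈ S.Typical
  D⇒typical y∈ = O⊆ λ n → y∈ (suc n)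

  hull⇒D : Y.Comeager (λ y → y ∈ D 0 → y ∈ ⋂ ℕ D)
  hull⇒D = Y.comeager O O-open O-dense λ y∈ → λ { y∈H zero → y∈H ; _ (suc n) → y∈ n }

  saturation⇒D : Y.Comeager (λ y → y ∈ Saturation → y ∈ ⋂ ℕ D)
  saturation⇒D = Y.com-mono
    (λ (to-D , sat) (h , x , x∈C , y≈) →
      to-D (Y.open-resp (D-open 0) y≈ (sat (Y.sym y≈) (record { h = h ; x = x ; x∈C = x∈C }) ≡.refl)))
    (Y.com-∩ hull⇒D (Y.com-≈ (Y.com-mono (λ ty → proj₂ (proj₂ ty)) S.typical)))

  -- The field `lim` ties x₀ to the branch of y, from which the continuity of `ψ` is read off.
  record Selected (y : Y.Carrier) (x₀ : X.Carrier) : Set where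
    field
      x₀∈C  : x₀ ∈ ⋂ ℕ C
      orbit : ∃ λ h → h ∗ f x₀ Y.≈ y
      lim   : X.Limit x (λ k → S.cell (S.path y k)) x₀

  module _ {y} (y∈D : y ∈ ⋂ ℕ D) where
    private
      y-typical = D⇒typical y∈D
      T = S.Pieces (y∈D 0) y-typical

    pieces↓ : Shrinking T
    pieces↓ = record
      { inhabited = λ k → let (m , y∈m) = Y.cover y
                              (r , r∈ , _) = S.pieces-cl (y∈D 0) y-typical k m y∈m
                          in r , r∈
      ; decreasing = S.pieces-decreasing (y∈D 0) y-typical }

    selection : ∃ (Selected y)
    selection =
      let
        T-fine = S.pieces-fine (y∈D 0) y-typical
        (x₀ , T→x) = X.limit x pieces↓ (λ j → T-fine (inj₁ j))
        (h₀ , T→h) = H.limit h pieces↓ (λ j → T-fine (inj₂ (inj₁ j)))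
        x₀∈C = λ n → X.limit-inside x {T} pieces↓ {x₀} {C n} T→x (T-fine (inj₂ (inj₂ n)))
      in x₀ , record
        { x₀∈C = x₀∈C
        ; orbit = h₀ , Y.sym (limit-≈ Y.polish pieces↓
            (Limit-· Y pieces↓ T→h (Limit-f {π = x} x∈C {x₀} x₀∈C T→x))
            (λ k y∈m → S.pieces-cl (y∈D 0) y-typical k _ y∈m))
        ; lim = T→x }

  ψ : Y.Carrier → X.Carrier
  ψ y with em {P = y ∈ ⋂ ℕ D}
  ... | yes y∈D = proj₁ (selection y∈D)
  ... | no _ = default

  ψ-selected : ∀ {y} → y ∈ ⋂ ℕ D → Selected y (ψ y)
  ψ-selected {y} y∈D with em {P = y ∈ ⋂ ℕ D}
  ... | yes y∈D = proj₂ (selection y∈D)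
  ... | no y∉D = contradiction y∈D y∉D

  D⊆Saturation : ⋂ ℕ D ⊆ Saturation
  D⊆Saturation {y} y∈D =
    let open Selected (ψ-selected {y} y∈D) in proj₁ orbit , ψ y , x₀∈C , proj₂ orbit

  -- Nearby points of the domain share an initial segment of their branches, so both values are
  -- limits of points of one cell; regularity absorbs the closure.
  ψ-cont : ContinuousOn Y.polish bX (⋂ ℕ D) ψ
  ψ-cont {y} y∈D ψy∈n =
    let
      (n , ψy∈n , cl⊆) = X.regular ψy∈n
      (k , ⊆n) = Selected.lim (ψ-selected {y} y∈D) ψy∈n
      (m , y∈m , same) = S.path-locally-constant (y∈D 0) (D⇒typical y∈D) k
    in m , y∈m , λ {z} z∈m z∈D → cl⊆
      (X.limit-cl x (pieces↓ {z} z∈D) (Selected.lim (ψ-selected {z} z∈D)) k λ {r} r∈ →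
        ⊆n (subst (λ s → r ∈ S.cell s) (same z∈m (z∈D 0) (D⇒typical z∈D)) r∈))

-- From metrics to countable bases

ν : ℕ → ℚ
ν zero = 0ℚ
ν (suc n) = 1ℚ ℚ.+ ν n

ν-toℚᵘ : ∀ n → ℚ.toℚᵘ (ν n) ℚᵘ.≃ ℚᵘ.mkℚᵘ (ℤ.+ n) 0
ν-toℚᵘ zero = ℚᵘ.*≡* ≡.refl
ν-toℚᵘ (suc n) = ℚᵘ.≃-trans (ℚ.toℚᵘ-homo-+ 1ℚ (ν n))
  (ℚᵘ.≃-trans (ℚᵘ.+-cong {ℚ.toℚᵘ 1ℚ} {ℚ.toℚᵘ 1ℚ} (ℚᵘ.≃-refl {ℚ.toℚᵘ 1ℚ}) (ν-toℚᵘ n))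
    (ℚᵘ.*≡* (cong (λ k → (ℤ.+ 1 ℤ.+ k) ℤ.* ℤ.+ 1) (ℤ.*-identityʳ (ℤ.+ n)))))

ν-nonneg : ∀ n → 0ℚ ℚ.≤ ν n
ν-nonneg zero = ℚ.≤-refl
ν-nonneg (suc n) = ℚ.+-mono-≤ {0ℚ} {1ℚ} (ℚ.<⇒≤ (ℚ.positive⁻¹ 1ℚ)) (ν-nonneg n)

-- The denominator of q serves as n, since q times it is a positive integer.
archimedean : ∀ {q} → 0ℚ ℚ.< q → ∃ λ n → 1ℚ ℚ.≤ q ℚ.* ν n
archimedean {mkℚ (ℤ.+ suc a) d c} _ = suc d , ℚ.toℚᵘ-cancel-≤ (ℚᵘ.≤-respʳ-≃ (ℚᵘ.≃-sym
  (ℚᵘ.≃-trans (ℚ.toℚᵘ-homo-* q (ν (suc d)))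
    (ℚᵘ.*-cong (ℚᵘ.≃-refl {ℚ.toℚᵘ q}) (ν-toℚᵘ (suc d))))) (ℚᵘ.*≤* (ℤ.+≤+ bound)))
  where
  q = mkℚ (ℤ.+ suc a) d c
  bound : 1 ℕ.* (suc d ℕ.* 1) ℕ.≤ (suc a ℕ.* suc d) ℕ.* 1
  bound = ℕ.≤-trans (ℕ.≤-reflexive (≡.trans (ℕ.*-identityˡ _) (ℕ.*-identityʳ (suc d))))
            (ℕ.≤-trans (ℕ.m≤n*m (suc d) (suc a)) (ℕ.≤-reflexive (≡.sym (ℕ.*-identityʳ _))))
archimedean {mkℚ (ℤ.+ zero) d c} (ℚ.*<* (ℤ.+<+ ()))
archimedean {mkℚ (ℤ.-[1+ a ]) d c} (ℚ.*<* ())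

rad : ℕ → ℚ
rad zero = 1ℚ
rad (suc n) = ½ ℚ.* rad n

rad-double : ∀ n → rad (suc n) ℚ.+ rad (suc n) ≡ rad n
rad-double n = ≡.trans (≡.sym (ℚ.*-distribʳ-+ (rad n) ½ ½)) (ℚ.*-identityˡ (rad n))

rad-positive : ∀ n → 0ℚ ℚ.< rad n
rad-positive zero = ℚ.positive⁻¹ 1ℚ
rad-positive (suc n) = subst (ℚ._< ½ ℚ.* rad n) (ℚ.*-zeroʳ ½) (ℚ.*-monoʳ-<-pos ½ (rad-positive n))

rad-step : ∀ n → rad (suc n) ℚ.< rad n
rad-step n = subst (rad (suc n) ℚ.<_) (rad-double n)
  (subst (ℚ._< rad (suc n) ℚ.+ rad (suc n)) (ℚ.+-identityʳ (rad (suc n)))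
    (ℚ.+-monoʳ-< (rad (suc n)) (rad-positive (suc n))))

rad-antitone : ∀ {m n} → m ℕ.≤ n → rad n ℚ.≤ rad m
rad-antitone {m} m≤n = go (ℕ.≤⇒≤′ m≤n)
  where
  go : ∀ {n} → m ℕ.≤′ n → rad n ℚ.≤ rad m
  go (ℕ.≤′-reflexive ≡.refl) = ℚ.≤-refl
  go (ℕ.≤′-step {n} m≤n) = ℚ.≤-trans (ℚ.<⇒≤ (rad-step n)) (go m≤n)

-- Bernoulli's inequality n + 1 ≤ 2ⁿ, without division.
rad-bound : ∀ n → rad n ℚ.* ν (suc n) ℚ.≤ 1ℚ
rad-bound zero = ℚ.≤-refl
rad-bound (suc n) = begin
  ½ ℚ.* rad n ℚ.* (1ℚ ℚ.+ ν (suc n))          ≡⟨ ring (rad n) (ν (suc n)) ⟩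
  ½ ℚ.* (rad n ℚ.+ rad n ℚ.* ν (suc n))
    ≤⟨ ℚ.*-monoˡ-≤-nonNeg ½ (ℚ.+-mono-≤ (rad-antitone {0} {n} ℕ.z≤n) (rad-bound n)) ⟩
  1ℚ                                          ∎
  where
  open ℚ.≤-Reasoning
  open +-*-Solver
  ring : ∀ r v → ½ ℚ.* r ℚ.* (1ℚ ℚ.+ v) ≡ ½ ℚ.* (r ℚ.+ r ℚ.* v)
  ring = solve 2 (λ r v → con ½ :* r :* (con 1ℚ :+ v) := con ½ :* (r :+ r :* v)) ≡.refl

rad-small : ∀ {q} → 0ℚ ℚ.< q → ∃ λ n → rad n ℚ.< q
rad-small {q} 0<q =
  let (n , 1≤qn) = archimedean 0<q in
  n , ℚ.≰⇒> λ q≤rad → ℚ.<-irrefl ≡.refl (ℚ.≤-<-trans 1≤qn (begin-strict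
    q ℚ.* ν n                   ≤⟨ ℚ.*-monoʳ-≤-nonNeg (ν n) {{ℚ.nonNegative (ν-nonneg n)}} q≤rad ⟩
    rad n ℚ.* ν n               ≡⟨ ℚ.+-identityˡ _ ⟨
    0ℚ ℚ.+ rad n ℚ.* ν n        <⟨ ℚ.+-monoˡ-< (rad n ℚ.* ν n) (rad-positive n) ⟩
    rad n ℚ.+ rad n ℚ.* ν n     ≡⟨ ring (rad n) (ν n) ⟩
    rad n ℚ.* ν (suc n)         ≤⟨ rad-bound n ⟩
    1ℚ                          ∎))
  where
  open ℚ.≤-Reasoning
  open +-*-Solver
  ring : ∀ r v → r ℚ.+ r ℚ.* v ≡ r ℚ.* (1ℚ ℚ.+ v)
  ring = solve 2 (λ r v → r :+ r :* v := r :* (con 1ℚ :+ v)) ≡.refl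

rad-below : ∀ x → 0ᴿ <ᴿ x → ∃ λ n → rad n ∈ ℝ.cut x
rad-below x (q , q≮0 , q∈) =
  let (q′ , q<q′ , q′∈) = ℝ.no-max x q∈
      (n , rad<q′) = rad-small (ℚ.≤-<-trans (ℚ.≮⇒≥ q≮0) q<q′)
  in n , ℝ.downward x (ℚ.<⇒≤ rad<q′) q′∈

0<rad : ∀ n → 0ᴿ <ᴿ fromℚ (rad n)
0<rad n = 0ℚ , ℚ.<-irrefl ≡.refl , rad-positive n

module Radius {S : Setoid 0ℓ 0ℓ} (ρ : Metric S) where
  open Setoid S
  open Metric ρ
  open ℝ

  record near (k : ℕ) (x y : Carrier) : Set where
    constructor within
    field
      close : y ∈ ball x (fromℚ (rad k))

  near-resp : ∀ {k x x′ y y′} → x ≈ x′ → y ≈ y′ → y ∈ near k x → y′ ∈ near k x′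
  near-resp x≈x′ y≈y′ (within (q , q∉ , q<)) = within (q , q∉ ∘ proj₂ (d-cong x≈x′ y≈y′) , q<)

  near-refl : ∀ {k x} → x ∈ near k x
  near-refl {k} = within (0ℚ , (λ 0∈ → ℚ.<-irrefl ≡.refl (proj₁ (≈⇒0 refl) 0∈)) , rad-positive k)

  near-sym : ∀ {k x y} → y ∈ near k x → x ∈ near k y
  near-sym {x = x} {y} (within (q , q∉ , q<)) = within (q , q∉ ∘ proj₁ (d-sym y x) , q<)

  near-trans : ∀ {k x y z} → y ∈ near (suc k) x → z ∈ near (suc k) y → z ∈ near k x
  near-trans {k} {x} {y} {z} (within (p , p∉ , p<)) (within (q , q∉ , q<)) = within
    (p ℚ.+ q ,
    (λ p+q∈ →
      let (a , b , a∈ , b∈ , p+q≤a+b) = triangle x y z p+q∈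
      in ℚ.<-irrefl ≡.refl (ℚ.≤-<-trans p+q≤a+b
           (ℚ.+-mono-< (below-bound (d x y) p∉ a∈) (below-bound (d y z) q∉ b∈)))) ,
    subst (p ℚ.+ q ℚ.<_) (rad-double k) (ℚ.+-mono-< p< q<))

  near-suc : ∀ {k x y} → y ∈ near (suc k) x → y ∈ near k x
  near-suc y∈ = near-trans y∈ near-refl

  near-within : ∀ {x ε} → 0ᴿ <ᴿ ε → ∃ λ k → near k x ⊆ ball x ε
  near-within {ε = ε} 0<ε =
    let (k , rad∈) = rad-below ε 0<ε
    in k , λ (within (q , q∉ , q<rad)) → q , q∉ , downward ε (ℚ.<⇒≤ q<rad) rad∈

  near-separated : ∀ {x y} → (∀ k → y ∈ near k x) → x ≈ y
  near-separated {x} {y} near-all = 0⇒≈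
    ( (λ {q} q∈ → ℚ.≰⇒> λ 0≤q →
        let (q′ , q<q′ , q′∈) = no-max (d x y) q∈
            (k , rad<q′) = rad-small (ℚ.≤-<-trans 0≤q q<q′)
            (within (p , p∉ , p<rad)) = near-all k
        in p∉ (downward (d x y) (ℚ.<⇒≤ (ℚ.<-trans p<rad rad<q′)) q′∈))
    , IsGeneralMetric.nonNegative isGeneralMetric )

module _ (T : TopologicalSpace) (isPolish : IsPolish T) (point : TopologicalSpace.Carrier T) where
  open TopologicalSpace T hiding (refl; sym; trans)
  open IsPolish isPolish
  open Metric metric
  open Radius metric

  private
    open⇒near : ∀ {V x} → Open V → x ∈ V → ∃ λ k → near k x ⊆ V
    open⇒near {V} oV x∈ =
      let (ε , 0<ε , ball⊆) = Equivalence.to (compatible {V}) oV x∈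
          (k , near⊆) = near-within {ε = ε} 0<ε
      in k , λ y∈ → ball⊆ (near⊆ y∈)

    near⇒open : ∀ {V} → (∀ {x} → x ∈ V → ∃ λ k → near k x ⊆ V) → Open V
    near⇒open {V} interior = Equivalence.from (compatible {V}) λ x∈ →
      let (k , near⊆) = interior x∈ in fromℚ (rad k) , 0<rad k , λ c → near⊆ (within c)

    near-open : ∀ k x → Open (near k x)
    near-open k x = Equivalence.from (compatible {near k x}) λ (within c) →
      let (ε , 0<ε , ball⊆) = ball-open x (fromℚ (rad k)) c in ε , 0<ε , λ y∈ → within (ball⊆ y∈)

    centre : ℕ → Carrier
    centre i with proj₁ separable i
    ... | just x  = x
    -- Gaps in the dense sequence are filled with `point`, so that every disc has a centre.
    ... | nothing = point

    centre-just : ∀ {i x} → proj₁ separable i ≡ just x → centre i ≡ x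
    centre-just {i} eq with proj₁ separable i | eq
    ... | just x | ≡.refl = ≡.refl

    centre-near : ∀ k x → ∃ λ i → x ∈ near k (centre i)
    centre-near k x =
      let (z , z∈ , i , eq) = proj₂ separable x (near k x) (near-open k x) near-refl
      in i , subst (λ z → x ∈ near k z) (≡.sym (centre-just eq)) (near-sym z∈)

    disc : ℕ × ℕ → Pred Carrier 0ℓ
    disc (i , j) = near j (centre i)

    code : ∀ i j → ∃ λ m → ∀ {x} → (x ∈ disc (i , j) → x ∈ disc (unpair m)) ×
                                   (x ∈ disc (unpair m) → x ∈ disc (i , j))
    code i j = let (m , eq) = pair i j in
      m , λ {x} → subst (λ p → x ∈ disc p) (≡.sym eq) , subst (λ p → x ∈ disc p) eq

    disc-in-near : ∀ k x → ∃ λ i → ∃ λ m → x ∈ disc (unpair m) × disc (unpair m) ⊆ near k x ×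
                   disc (unpair m) ⊆ near (suc k) (centre i)
    disc-in-near k x =
      let (i , x∈) = centre-near (suc k) x
          (m , both) = code i (suc k)
      in i , m , proj₁ both x∈ ,
         (λ y∈ → near-trans (near-sym x∈) (proj₂ both y∈)) , (λ y∈ → proj₂ both y∈)

    disc-open : ∀ p → Open (disc p)
    disc-open (i , j) = near-open j (centre i)

  metric-base : Base Carrier
  metric-base = record
    { B = λ m → disc (unpair m)
    ; nonempty = λ m → centre (proj₁ (unpair m)) , near-refl
    ; cover = λ x → let (_ , m , x∈ , _) = disc-in-near 0 x in m , x∈
    ; meet = λ {m} {n} {x} x∈m x∈n →
        let (k , near⊆) = open⇒near (Open-∩ (disc-open (unpair m)) (disc-open (unpair n))) (x∈m , x∈n)
            (_ , p , x∈p , p⊆ , _) = disc-in-near k x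
        in p , x∈p , (λ y∈ → proj₁ (near⊆ (p⊆ y∈))) , (λ y∈ → proj₂ (near⊆ (p⊆ y∈)))
    }

  open Base metric-base

  opaque
    polish-base : PolishBase setoid
    polish-base = record
      { base = metric-base
      ; B-resp = λ m x≈y x∈ → near-resp (Setoid.refl setoid) x≈y x∈
      ; regular = λ {m} {x} x∈m →
          let (k , near⊆) = open⇒near (disc-open (unpair m)) x∈m
              (_ , p , x∈p , _ , p⊆) = disc-in-near (suc k) x
          in p , x∈p , λ {y} y∈cl →
            let (_ , q , y∈q , q⊆ , _) = disc-in-near (suc (suc k)) y
                (w , w∈q , w∈p) = y∈cl q y∈q
            in near⊆ (near-trans (near-trans (near-sym (p⊆ x∈p)) (p⊆ w∈p)) (near-sym (near-suc (q⊆ w∈q))))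
      ; T₀ = λ {x} {y} x⇒y → near-separated λ k →
          let (_ , m , x∈m , m⊆ , _) = disc-in-near k x in m⊆ (x⇒y m x∈m)
      -- The radius is 2⁻ʲ⁻¹, so that two points of a tile in row j are within 2⁻ʲ of each other.
      ; tile = λ j i → proj₁ (code i (suc j))
      ; tile-cover = λ j x → let (i , x∈) = centre-near (suc j) x in i , proj₁ (proj₂ (code i (suc j))) x∈
      ; complete = λ T T↓ fine →
          let
            open Shrinking T↓
            narrow : ∀ j → ∃ λ k → ∀ {x y} → x ∈ T k → y ∈ T k → y ∈ near j x
            narrow j = let (i , k , T⊆) = fine j ; code-of = proj₂ (code i (suc j)) in
              k , λ x∈ y∈ → near-trans (near-sym (proj₂ code-of (T⊆ x∈))) (proj₂ code-of (T⊆ y∈))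
            t = λ k → proj₁ (inhabited k)
            t∈ : ∀ k → t k ∈ T k
            t∈ k = proj₂ (inhabited k)
            (z , t→z) = complete t λ ε 0<ε →
              let (j , rad∈) = rad-below ε 0<ε
                  (k , close) = narrow j
              in k , λ m n k≤m k≤n →
                let (within (q , q∉ , q<)) = close (decreasing-≤ k≤m (t∈ m)) (decreasing-≤ k≤n (t∈ n))
                in q , q∉ , ℝ.downward ε (ℚ.<⇒≤ q<) rad∈
          in z , λ {m} z∈m →
            let (j , near⊆) = open⇒near (disc-open (unpair m)) z∈m
                (k , close) = narrow (suc j)
                (N , eventually) = t→z (near (suc j) z) (near-open (suc j) z) near-refl
                n = N ℕ.⊔ k
                tn∈ = decreasing-≤ (ℕ.m≤n⊔m N k) (t∈ n)
            in k , λ r∈ → near⊆ (near-trans (eventually n (ℕ.m≤m⊔n N k)) (close tn∈ r∈))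
      }

    open⇒base : ∀ {V} → Open V → PolishBase.IsOpen polish-base V
    open⇒base oV {x} x∈ =
      let (k , near⊆) = open⇒near oV x∈
          (_ , m , x∈m , m⊆ , _) = disc-in-near k x
      in m , x∈m , λ y∈ → near⊆ (m⊆ y∈)

    base⇒open : ∀ {V : Pred Carrier 0ℓ} → PolishBase.IsOpen polish-base V → Open V
    base⇒open oV = near⇒open λ x∈ →
      let (m , x∈m , m⊆) = oV x∈
          (k , near⊆) = open⇒near (disc-open (unpair m)) x∈m
      in k , λ y∈ → m⊆ (near⊆ y∈)

-- Right-invariant metrics on Polish groups

module Infimum (em : ∀ {ℓ} → ExcludedMiddle ℓ) where
  open Choice em

  LowerBound : Pred ℚ 0ℓ → Pred ℚ 0ℓ
  LowerBound P a = ∀ {c} → c ∈ P → a ℚ.≤ c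

  not-lower : ∀ {P a} → a ∉ LowerBound P → ∃ λ c → c ∈ P × c ℚ.< a
  not-lower a∉ = by-contradiction λ none → a∉ λ c∈ → ℚ.≮⇒≥ λ c<a → none (_ , c∈ , c<a)

  -- A rational approximation suffices. The first multiple of η whose successor exceeds a member of
  -- `P` is a lower bound, by minimality or, for the multiple 0, by hypothesis; the search ends
  -- because 1 is in `P`.
  infimum : ∀ {P} → 1ℚ ∈ P → 0ℚ ∈ LowerBound P → ∀ {η} → 0ℚ ℚ.< η →
            ∃ λ a → a ∈ LowerBound P × ∃ λ c → c ∈ P × c ℚ.< a ℚ.+ η
  infimum {P} 1∈ 0-lower {η} 0<η =
    let (n , 1≤ηn) = archimedean 0<η
        (k , k-over , below) = least {Overshoots} n (1ℚ , 1∈ , subst (1ℚ ℚ.<_) (next n)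
          (ℚ.≤-<-trans 1≤ηn (subst (ℚ._< η ℚ.* ν n ℚ.+ η) (ℚ.+-identityʳ _)
            (ℚ.+-monoʳ-< (η ℚ.* ν n) 0<η))))
        (c , c∈ , c<) = k-over
    in η ℚ.* ν k , lower k below , c , c∈ , subst (c ℚ.<_) (≡.sym (next k)) c<
    where
    Overshoots : ℕ → Set
    Overshoots n = ∃ λ c → c ∈ P × c ℚ.< η ℚ.* ν (suc n)
    next : ∀ n → η ℚ.* ν n ℚ.+ η ≡ η ℚ.* ν (suc n)
    next n = ring η (ν n)
      where
      open +-*-Solver
      ring : ∀ η v → η ℚ.* v ℚ.+ η ≡ η ℚ.* (1ℚ ℚ.+ v)
      ring = solve 2 (λ η v → η :* v :+ η := η :* (con 1ℚ :+ v)) ≡.refl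
    lower : ∀ k → (∀ {j} → j ℕ.< k → j ∉ Overshoots) → η ℚ.* ν k ∈ LowerBound P
    lower zero _ = subst (_∈ LowerBound P) (≡.sym (ℚ.*-zeroʳ η)) 0-lower
    lower (suc k) below c∈ = ℚ.≮⇒≥ λ c< → below (ℕ.n<1+n k) (_ , c∈ , c<)

-- The Birkhoff–Kakutani theorem: a chain of neighbourhoods Uₙ of the identity
-- with Uₙ₊₁³ ⊆ Uₙ is used to give each element of Uₙ the price 2⁻ⁿ, and the
-- distance of x and y is the infimum of the prices of factorisations of y x⁻¹.
module BirkhoffKakutani (em : ∀ {ℓ} → ExcludedMiddle ℓ) (G : BaseGroup) where
  open Choice em
  open Infimum em
  open BaseGroup G
  open ℝ
  open import Algebra.Properties.Group group using (⁻¹-anti-homo-∙; ε⁻¹≈ε; ⁻¹-involutive; x∙y⁻¹≈ε⇒x≈y)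

  Sym : ℕ → Pred Carrier 0ℓ
  Sym m g = g ∈ B m × g ⁻¹ ∈ B m

  Thirds : ℕ → ℕ → Set
  Thirds m n = ∀ {u v w} → u ∈ Sym n → v ∈ Sym n → w ∈ Sym n → u ∙ v ∙ w ∈ B m

  third : ∀ {m} → ε ∈ B m → ∃ λ n → ε ∈ B n × B n ⊆ B m × Thirds m n
  third {m} ε∈m =
    let (a , b , ε∈a , ε∈b , ab⊆) = ∙-cont (B-resp m (sym (identityˡ ε)) ε∈m)
        (c , d , ε∈c , ε∈d , cd⊆) = ∙-cont (B-resp a (sym (identityˡ ε)) ε∈a)
        (p , ε∈p , p⊆m , p⊆b) = meet ε∈m ε∈b
        (q , ε∈q , q⊆c , q⊆d) = meet ε∈c ε∈d
        (n , ε∈n , n⊆p , n⊆q) = meet ε∈p ε∈q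
    in n , ε∈n , p⊆m ∘ n⊆p , λ (u∈ , _) (v∈ , _) (w∈ , _) →
      ab⊆ (cd⊆ (q⊆c (n⊆q u∈)) (q⊆d (n⊆q v∈))) (p⊆b (n⊆p w∈))

  private
    ε-base = Neighbourhoods.neighbourhoods em base ε {Thirds} third
      λ thirds k⊆n → λ (u , u′) (v , v′) (w , w′) →
        thirds (k⊆n u , k⊆n u′) (k⊆n v , k⊆n v′) (k⊆n w , k⊆n w′)
  open NeighbourhoodBase (proj₁ ε-base)

  -- Starting from the whole group gives every element the price 1, so costs exist and distances are
  -- bounded.
  V : ℕ → Pred Carrier 0ℓ
  V zero = U
  V (suc n) = Sym (nb n)

  V-resp : ∀ n → ∀ {g h} → g ≈ h → g ∈ V n → h ∈ V n
  V-resp zero _ _ = tt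
  V-resp (suc n) g≈h (g∈ , g⁻¹∈) = B-resp _ g≈h g∈ , B-resp _ (⁻¹-cong g≈h) g⁻¹∈

  ε∈V : ∀ n → ε ∈ V n
  ε∈V zero = tt
  ε∈V (suc n) = ∈nb n , B-resp _ (sym ε⁻¹≈ε) (∈nb n)

  V-inverse : ∀ n {g} → g ∈ V n → g ⁻¹ ∈ V n
  V-inverse zero _ = tt
  V-inverse (suc n) {g} (g∈ , g⁻¹∈) = g⁻¹∈ , B-resp _ (sym (⁻¹-involutive g)) g∈

  V-open : ∀ n → IsOpen (V n)
  V-open zero = U-open
  V-open (suc n) = ∩-open (B-open (nb n)) (⁻¹-open (B-open (nb n)))

  V-thirds : ∀ n {u v w} → u ∈ V (suc n) → v ∈ V (suc n) → w ∈ V (suc n) → u ∙ v ∙ w ∈ V n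
  V-thirds zero _ _ _ = tt
  V-thirds (suc n) {u} {v} {w} u∈ v∈ w∈ =
    proj₂ ε-base n u∈ v∈ w∈ ,
    B-resp _ (sym reversed) (proj₂ ε-base n (V-inverse (suc (suc n)) w∈)
      (V-inverse (suc (suc n)) v∈) (V-inverse (suc (suc n)) u∈))
    where
    reversed : (u ∙ v ∙ w) ⁻¹ ≈ w ⁻¹ ∙ v ⁻¹ ∙ u ⁻¹
    reversed = trans (⁻¹-anti-homo-∙ (u ∙ v) w)
      (trans (∙-congˡ (⁻¹-anti-homo-∙ u v)) (sym (assoc _ _ _)))

  V-antitone : ∀ {m n} → m ℕ.≤ n → V n ⊆ V m
  V-antitone {m} m≤n = go (ℕ.≤⇒≤′ m≤n)
    where
    go : ∀ {n} → m ℕ.≤′ n → V n ⊆ V m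
    go (ℕ.≤′-reflexive ≡.refl) = id
    go (ℕ.≤′-step {n} m≤n) u∈ = go m≤n (V-resp n (trans (identityʳ _) (identityʳ _))
      (V-thirds n u∈ (ε∈V (suc n)) (ε∈V (suc n))))

  V-small : ∀ {m} → ε ∈ B m → ∃ λ n → V n ⊆ B m
  V-small ε∈ = let (k , k⊆) = nb-⊆ ε∈ in suc k , λ (g∈ , _) → k⊆ g∈

  -- The number of factors is recorded to serve as the recursion measure when factorisations are
  -- cut.
  data Price : ℕ → Carrier → ℚ → Set where
    stop : ∀ {g} → g ≈ ε → Price 0 g 0ℚ
    step : ∀ {k g h u} n {c} → u ∈ V n → Price k h c → g ≈ u ∙ h → Price (suc k) g (rad n ℚ.+ c)

  price-resp : ∀ {k g h c} → g ≈ h → Price k g c → Price k h c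
  price-resp g≈h (stop g≈ε) = stop (trans (sym g≈h) g≈ε)
  price-resp g≈h (step n u∈ p g≈) = step n u∈ p (trans (sym g≈h) g≈)

  price-nonneg : ∀ {k g c} → Price k g c → 0ℚ ℚ.≤ c
  price-nonneg (stop _) = ℚ.≤-refl
  price-nonneg (step n _ p _) = ℚ.+-mono-≤ (ℚ.<⇒≤ (rad-positive n)) (price-nonneg p)

  price-∙ : ∀ {k l g h c c′} → Price k g c → Price l h c′ → Price (k + l) (g ∙ h) (c ℚ.+ c′)
  price-∙ {l = l} {g} {h} {c′ = c′} (stop g≈ε) q = subst (Price l (g ∙ h)) (≡.sym (ℚ.+-identityˡ c′))
    (price-resp (sym (trans (∙-congʳ g≈ε) (identityˡ _))) q)
  price-∙ {suc k} {l} {g} {h} {c′ = c′} (step n {c} u∈ p g≈) q =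
    subst (Price (suc k + l) (g ∙ h)) (≡.sym (ℚ.+-assoc (rad n) c c′))
      (step n u∈ (price-∙ p q) (trans (∙-congʳ g≈) (assoc _ _ _)))

  price-single : ∀ n {u} → u ∈ V n → Price 1 u (rad n)
  price-single n {u} u∈ = subst (Price 1 u) (ℚ.+-identityʳ (rad n))
    (step n u∈ (stop refl) (sym (identityʳ u)))

  price-⁻¹ : ∀ {k g c} → Price k g c → ∃ λ l → Price l (g ⁻¹) c
  price-⁻¹ (stop g≈ε) = 0 , stop (trans (⁻¹-cong g≈ε) ε⁻¹≈ε)
  price-⁻¹ {g = g} (step {h = h} {u} n {c} u∈ p g≈) =
    let (l , p′) = price-⁻¹ p in
    l + 1 , subst (Price (l + 1) (g ⁻¹)) (ℚ.+-comm c (rad n))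
      (price-resp (sym (trans (⁻¹-cong g≈) (⁻¹-anti-homo-∙ u h)))
        (price-∙ p′ (price-single n (V-inverse n u∈))))

  record Split (k : ℕ) (g : Carrier) (c t : ℚ) : Set where
    field
      {k₁ k₂ n}   : ℕ
      {g₁ v g₂}   : Carrier
      {c₁ c₂}     : ℚ
      before      : Price k₁ g₁ c₁
      middle      : v ∈ V n
      after       : Price k₂ g₂ c₂
      product     : g ≈ g₁ ∙ v ∙ g₂
      total       : c ≡ c₁ ℚ.+ rad n ℚ.+ c₂
      under       : c₁ ℚ.< t
      over        : t ℚ.≤ c₁ ℚ.+ rad n
      k₁<k        : k₁ ℕ.< k
      k₂<k        : k₂ ℕ.< k

  -- Partial prices grow from 0 to at least t; the factor at which they first reach t is the middle
  -- one.
  split : ∀ {k g c} t → 0ℚ ℚ.< t → t ℚ.≤ c → Price k g c → Split k g c t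
  split t 0<t t≤0 (stop _) = contradiction (ℚ.<-≤-trans 0<t t≤0) (ℚ.<-irrefl ≡.refl)
  split {g = g} t 0<t t≤c (step {k} {h = h} {u} n {c} u∈ p g≈) with t ℚ.≤? rad n
  ... | yes t≤rad = record
    { n = n ; before = stop refl ; middle = u∈ ; after = p
    ; product = trans g≈ (∙-congʳ (sym (identityˡ u)))
    ; total = cong (ℚ._+ c) (≡.sym (ℚ.+-identityˡ (rad n)))
    ; under = 0<t ; over = subst (t ℚ.≤_) (≡.sym (ℚ.+-identityˡ (rad n))) t≤rad
    ; k₁<k = ℕ.s≤s ℕ.z≤n ; k₂<k = ℕ.n<1+n k }
  ... | no t≰rad = record
    { n = n₁ ; before = step n u∈ before refl ; middle = middle ; after = after
    ; product = trans g≈ (trans (∙-congˡ product)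
        (trans (sym (assoc u _ g₂)) (∙-congʳ (sym (assoc u g₁ _)))))
    ; total = ≡.trans (cong (rad n ℚ.+_) total) (assoc₃ (rad n) c₁ (rad n₁) c₂)
    ; under = subst (rad n ℚ.+ c₁ ℚ.<_) rejoin (ℚ.+-monoʳ-< (rad n) under)
    ; over = ℚ.≤-trans (ℚ.≤-reflexive (≡.sym rejoin))
        (ℚ.≤-trans (ℚ.+-monoʳ-≤ (rad n) over) (ℚ.≤-reflexive (≡.sym (ℚ.+-assoc (rad n) c₁ (rad n₁)))))
    ; k₁<k = ℕ.s≤s k₁<k ; k₂<k = ℕ.m<n⇒m<1+n k₂<k }
    where
    open +-*-Solver
    rejoin : rad n ℚ.+ (t ℚ.- rad n) ≡ t
    rejoin = solve 2 (λ r t → r :+ (t :- r) := t) ≡.refl (rad n) t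
    cancel : rad n ℚ.+ c ℚ.- rad n ≡ c
    cancel = solve 2 (λ r c → r :+ c :- r := c) ≡.refl (rad n) c
    assoc₃ : ∀ a b c d → a ℚ.+ (b ℚ.+ c ℚ.+ d) ≡ a ℚ.+ b ℚ.+ c ℚ.+ d
    assoc₃ = solve 4 (λ a b c d → a :+ (b :+ c :+ d) := a :+ b :+ c :+ d) ≡.refl
    open Split (split (t ℚ.- rad n)
      (subst (ℚ._< t ℚ.- rad n) (ℚ.+-inverseʳ (rad n)) (ℚ.+-monoˡ-< (ℚ.- rad n) (ℚ.≰⇒> t≰rad)))
      (subst (t ℚ.- rad n ℚ.≤_) cancel (ℚ.+-monoˡ-≤ (ℚ.- rad n) t≤c)) p)
      renaming (n to n₁)

  ≤-+ˡ : ∀ {a b} → 0ℚ ℚ.≤ a → b ℚ.≤ a ℚ.+ b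
  ≤-+ˡ {a} {b} 0≤a = subst (ℚ._≤ a ℚ.+ b) (ℚ.+-identityˡ b) (ℚ.+-monoˡ-≤ b 0≤a)

  ≤-+ʳ : ∀ {a b} → 0ℚ ℚ.≤ b → a ℚ.≤ a ℚ.+ b
  ≤-+ʳ {a} {b} 0≤b = subst (ℚ._≤ a ℚ.+ b) (ℚ.+-identityʳ a) (ℚ.+-monoʳ-≤ a 0≤b)

  rad-cancel : ∀ {m n} → rad n ℚ.< rad m → m ℕ.< n
  rad-cancel rad< = ℕ.≰⇒> λ n≤m → ℚ.<-irrefl ≡.refl (ℚ.<-≤-trans rad< (rad-antitone n≤m))

  -- Cutting a factorisation of price < 2⁻ⁿ at half that price leaves two
  -- shorter ones of price < 2⁻ⁿ⁻¹ around one factor.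
  cheap⇒V : ∀ N {k g c} n → k ℕ.≤ N → Price k g c → c ℚ.< rad n → g ∈ V n
  cheap⇒V _ n _ (stop g≈ε) _ = V-resp n (sym g≈ε) (ε∈V n)
  cheap⇒V (suc N) {suc k} {g} n (ℕ.s≤s k≤N) p@(step {h = h} {u} m {c} u∈ p′ g≈) c<
    with rad m ℚ.+ c ℚ.<? rad (suc n)
  -- The total stays below 2⁻ⁿ⁻¹, so there is no factor to cut at: the first one is split off and
  -- `ε` serves as the third.
  ... | yes small = V-resp n (sym (trans g≈ (sym (identityʳ _))))
    (V-thirds n
      (V-antitone {suc n} {m}
        (ℕ.<⇒≤ (rad-cancel {suc n} {m} (ℚ.≤-<-trans (≤-+ʳ (price-nonneg p′)) small))) u∈)
      (cheap⇒V N (suc n) k≤N p′ (ℚ.≤-<-trans (≤-+ˡ (ℚ.<⇒≤ (rad-positive m))) small)) (ε∈V (suc n)))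
  ... | no large = V-resp n (sym product)
    (V-thirds n (cheap⇒V N (suc n) (ℕ.≤-trans (ℕ.s≤s⁻¹ k₁<k) k≤N) before under)
      (V-antitone {suc n} {m′} (rad-cancel {n} {m′} (ℚ.≤-<-trans rad≤c c<)) middle)
      (cheap⇒V N (suc n) (ℕ.≤-trans (ℕ.s≤s⁻¹ k₂<k) k≤N) after
        (ℚ.≰⇒> λ rad≤c₂ → ℚ.<-irrefl ≡.refl (ℚ.<-≤-trans c< (begin
          rad n                             ≡⟨ rad-double n ⟨
          rad (suc n) ℚ.+ rad (suc n)       ≤⟨ ℚ.+-mono-≤ over rad≤c₂ ⟩
          c₁ ℚ.+ rad m′ ℚ.+ c₂              ≡⟨ total ⟨
          rad m ℚ.+ c                       ∎)))))
    where
    open Split (split (rad (suc n)) (rad-positive (suc n)) (ℚ.≮⇒≥ large) p) renaming (n to m′)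
    open ℚ.≤-Reasoning
    rad≤c : rad m′ ℚ.≤ rad m ℚ.+ c
    rad≤c = subst (rad m′ ℚ.≤_) (≡.sym total)
      (ℚ.≤-trans (≤-+ˡ (price-nonneg before)) (≤-+ʳ (price-nonneg after)))

  Cost : Carrier → Carrier → Pred ℚ 0ℓ
  Cost x y c = ∃ λ k → Price k (y ∙ x ⁻¹) c

  1-cost : ∀ x y → 1ℚ ∈ Cost x y
  1-cost x y = 1 , price-single 0 tt

  0-lower : ∀ x y → 0ℚ ∈ LowerBound (Cost x y)
  0-lower x y (_ , p) = price-nonneg p

  -- The lower cut of the infimum of the costs; the gap between q and q′ is what gives `no-max`.
  dist : Carrier → Carrier → ℝ
  dist x y = record
    { cut       = λ q → ∃ λ q′ → q ℚ.< q′ × q′ ∈ LowerBound (Cost x y)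
    ; inhabited = ℚ.- 1ℚ , 0ℚ , ℚ.negative⁻¹ (ℚ.- 1ℚ) , 0-lower x y
    ; bounded   = 1ℚ , λ (q′ , 1<q′ , lower) →
        ℚ.<-irrefl ≡.refl (ℚ.<-≤-trans 1<q′ (lower (1-cost x y)))
    ; downward  = λ p≤q (q′ , q<q′ , lower) → q′ , ℚ.≤-<-trans p≤q q<q′ , lower
    ; no-max    = λ (q′ , q<q′ , lower) →
        let (p , q<p , p<q′) = ℚ.<-dense q<q′ in p , q<p , q′ , p<q′ , lower
    }

  dist-≤ : ∀ {x y x′ y′} → (∀ {c} → c ∈ Cost x′ y′ → c ∈ Cost x y) → dist x y ≤ᴿ dist x′ y′
  dist-≤ cost⇒ (q′ , q<q′ , lower) = q′ , q<q′ , λ c∈ → lower (cost⇒ c∈)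

  cost-resp : ∀ {x y x′ y′ c} → y ∙ x ⁻¹ ≈ y′ ∙ x′ ⁻¹ → c ∈ Cost x y → c ∈ Cost x′ y′
  cost-resp eq (k , p) = k , price-resp eq p

  dist-cong : ∀ {x y x′ y′} → y ∙ x ⁻¹ ≈ y′ ∙ x′ ⁻¹ → dist x y ≃ᴿ dist x′ y′
  dist-cong {x} {y} {x′} {y′} eq =
    dist-≤ {x} {y} {x′} {y′} (cost-resp {x′} {y′} {x} {y} (sym eq)) ,
    dist-≤ {x′} {y′} {x} {y} (cost-resp {x} {y} {x′} {y′} eq)

  cost-sym : ∀ x y {c} → c ∈ Cost x y → c ∈ Cost y x
  cost-sym x y (k , p) = let (l , p′) = price-⁻¹ p in
    l , price-resp (trans (⁻¹-anti-homo-∙ y (x ⁻¹)) (∙-congʳ (⁻¹-involutive x))) p′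

  dist-triangle : ∀ x y z → dist x z ≤ᴿ dist x y +ᴿ dist y z
  dist-triangle x y z {q} (q′ , q<q′ , lower) =
    let
      (n , rad<) = rad-small (subst (ℚ._< q′ ℚ.- q) (ℚ.+-inverseʳ q) (ℚ.+-monoˡ-< (ℚ.- q) q<q′))
      -- One η is lost in approximating the infimum and one each in entering the two open cuts; 3η ≤
      -- 2⁻ⁿ < q′ - q.
      η = rad (suc (suc n))
      0<η = rad-positive (suc (suc n))
      (a , a-lower , c₁ , (k₁ , p₁) , c₁<) = infimum (1-cost x y) (0-lower x y) 0<η
      b = q′ ℚ.- (a ℚ.+ η)
      b-lower : b ∈ LowerBound (Cost y z)
      b-lower {c₂} (k₂ , p₂) =
        subst (b ℚ.≤_) (cancel (a ℚ.+ η) c₂) (ℚ.+-monoˡ-≤ (ℚ.- (a ℚ.+ η))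
          (ℚ.≤-trans (lower (k₂ + k₁ , price-resp (telescope z y x) (price-∙ p₂ p₁)))
            (ℚ.≤-trans (ℚ.≤-reflexive (ℚ.+-comm c₂ c₁)) (ℚ.+-monoˡ-≤ c₂ (ℚ.<⇒≤ c₁<)))))
    in a ℚ.- η , b ℚ.- η , (a , below 0<η , λ {c} → a-lower {c}) , (b , below 0<η , λ {c} → b-lower {c}) ,
       ℚ.≤-trans (ℚ.≤-reflexive (≡.sym (split-q q q′)))
         (ℚ.≤-trans (ℚ.+-monoʳ-≤ q′ (ℚ.neg-antimono-≤ (ℚ.≤-trans (three≤four n) (ℚ.<⇒≤ rad<))))
           (ℚ.≤-reflexive (collect q′ a η)))
    where
    open +-*-Solver
    telescope : ∀ z y x → (z ∙ y ⁻¹) ∙ (y ∙ x ⁻¹) ≈ z ∙ x ⁻¹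
    telescope z y x = trans (sym (assoc _ y (x ⁻¹))) (∙-congʳ ([gh⁻¹]h≈g z y))
    cancel : ∀ a c → a ℚ.+ c ℚ.- a ≡ c
    cancel = solve 2 (λ a c → a :+ c :- a := c) ≡.refl
    split-q : ∀ q q′ → q′ ℚ.- (q′ ℚ.- q) ≡ q
    split-q = solve 2 (λ q q′ → q′ :- (q′ :- q) := q) ≡.refl
    collect : ∀ q′ a η → q′ ℚ.- (η ℚ.+ η ℚ.+ η) ≡ (a ℚ.- η) ℚ.+ (q′ ℚ.- (a ℚ.+ η) ℚ.- η)
    collect = solve 3 (λ q′ a η → q′ :- (η :+ η :+ η) := (a :- η) :+ (q′ :- (a :+ η) :- η)) ≡.refl
    below : ∀ {a η} → 0ℚ ℚ.< η → a ℚ.- η ℚ.< a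
    below {a} {η} 0<η = subst (a ℚ.- η ℚ.<_) (ℚ.+-identityʳ a) (ℚ.+-monoʳ-< a (ℚ.neg-antimono-< 0<η))
    three≤four : ∀ n → let η = rad (suc (suc n)) in η ℚ.+ η ℚ.+ η ℚ.≤ rad n
    three≤four n = begin
      η ℚ.+ η ℚ.+ η                     ≡⟨ cong (ℚ._+ η) (rad-double (suc n)) ⟩
      rad (suc n) ℚ.+ η                 ≤⟨ ℚ.+-monoʳ-≤ (rad (suc n)) (ℚ.<⇒≤ (rad-step (suc n))) ⟩
      rad (suc n) ℚ.+ rad (suc n)       ≡⟨ rad-double n ⟩
      rad n                             ∎
      where
      open ℚ.≤-Reasoning
      η = rad (suc (suc n))

  V⇒close : ∀ {x y n} → y ∙ x ⁻¹ ∈ V (suc n) → dist x y <ᴿ fromℚ (rad n)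
  V⇒close {n = n} yx⁻¹∈ = rad (suc n) ,
    (λ (q′ , rad<q′ , lower) →
      ℚ.<-irrefl ≡.refl (ℚ.<-≤-trans rad<q′ (lower (1 , price-single (suc n) yx⁻¹∈)))) ,
    rad-step n

  close⇒V : ∀ {x y n} → dist x y <ᴿ fromℚ (rad n) → y ∙ x ⁻¹ ∈ V n
  close⇒V {x} {y} {n} (q , q∉ , q<rad) =
    let (c , (k , p) , c<rad) = not-lower {Cost x y} {rad n} (λ lower → q∉ (rad n , q<rad , λ {c} → lower {c}))
    in cheap⇒V k n ℕ.≤-refl p c<rad

  V-separated : ∀ {x y} → (∀ n → y ∙ x ⁻¹ ∈ V n) → x ≈ y
  V-separated {x} {y} all = sym (x∙y⁻¹≈ε⇒x≈y y x
    (sym (T₀ λ m ε∈m → let (n , n⊆) = V-small ε∈m in n⊆ (all n))))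

  metric : Metric setoid
  metric = record
    { d = dist
    ; isGeneralMetric = record
      { isSemiMetric = record
        { isQuasiSemiMetric = record
          { isPreMetric = record
            { isProtoMetric = record
              { isPartialOrder = record
                { isPreorder = record
                  { isEquivalence = record
                    { refl = id , id
                    ; sym = λ (f , g) → g , f
                    ; trans = λ (f , g) (f′ , g′) → f′ ∘ f , g ∘ g′ }
                  ; reflexive = proj₁
                  ; trans = λ f g → g ∘ f }
                ; antisym = λ f g → f , g }
              ; ≈-isEquivalence = isEquivalence
              ; cong = λ {x} {x′} {y} {y′} x≈ y≈ → dist-cong {x} {y} {x′} {y′} (∙-cong y≈ (⁻¹-cong x≈))
              ; nonNegative = λ {x} {y} q<0 → 0ℚ , q<0 , λ {c} → 0-lower x y {c} }
            ; ≈⇒0 = λ {x} {y} x≈y →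
                (λ (q′ , q<q′ , lower) → ℚ.<-≤-trans q<q′
                  (lower (0 , stop (trans (∙-congʳ (sym x≈y)) (inverseʳ x))))) ,
                (λ q<0 → 0ℚ , q<0 , λ {c} → 0-lower x y {c}) }
          ; 0⇒≈ = λ {x} {y} (d≤0 , _) → V-separated λ n →
              close⇒V {x} {y} {n} (0ℚ , (λ 0∈ → ℚ.<-irrefl ≡.refl (d≤0 0∈)) , rad-positive n) }
        ; sym = λ x y → dist-≤ {x} {y} {y} {x} (cost-sym y x) , dist-≤ {y} {x} {x} {y} (cost-sym x y) }
      ; triangle = dist-triangle } }

  open Metric metric using (MetricOpen; Cauchy)

  open⇒metric : ∀ {W : Pred Carrier 0ℓ} → IsOpen W → MetricOpen W
  open⇒metric {W} oW {x} x∈ =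
    let (m , ε∈m , m⊆) = ∙ʳ-open x oW (open-resp oW (sym (identityˡ x)) x∈)
        (n , n⊆m) = V-small ε∈m
    in fromℚ (rad n) , 0<rad n , λ {y} close →
         open-resp oW ([gh⁻¹]h≈g y x) (m⊆ (n⊆m (close⇒V {x} {y} {n} close)))

  V-within : ∀ r → 0ᴿ <ᴿ r → ∃ λ n → ∀ {x y} → y ∙ x ⁻¹ ∈ V n → dist x y <ᴿ r
  V-within r 0<r = let (n , rad∈) = rad-below r 0<r in
    suc n , λ {x} {y} yx⁻¹∈ → let (q , q∉ , q<) = V⇒close {x} {y} {n} yx⁻¹∈ in
      q , q∉ , downward r (ℚ.<⇒≤ q<) rad∈

  metric⇒open : ∀ {W : Pred Carrier 0ℓ} → MetricOpen W → IsOpen W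
  metric⇒open mW {x} x∈ =
    let (r , 0<r , ball⊆) = mW x∈
        (n , V⊆) = V-within r 0<r
        (m , x∈m , m⊆) = ∙ʳ-open (x ⁻¹) (V-open n) (V-resp n (sym (inverseʳ x)) (ε∈V n))
    in m , x∈m , λ y∈ → ball⊆ (V⊆ (m⊆ y∈))

  dist-invariant : ∀ g h k → dist (g ∙ k) (h ∙ k) ≃ᴿ dist g h
  dist-invariant g h k = dist-cong {g ∙ k} {h ∙ k} {g} {h}
    (trans (∙-congˡ (⁻¹-anti-homo-∙ g k)) (trans (sym (assoc _ (k ⁻¹) (g ⁻¹))) (∙-congʳ ([gh]h⁻¹≈g h k))))

  cauchy : ∀ {s} → RightCauchyᴮ s → Cauchy s
  cauchy s-cauchy r 0<r =
    let (n , V⊆) = V-within r 0<r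
        (m , ε∈m , m⊆) = V-open n (ε∈V n)
        (N , close) = s-cauchy ε∈m
    in N , λ i j N≤i N≤j → V⊆ (m⊆ (close N≤i N≤j))

-- The invariant sets X₀ and Y₀

module StarReduction (em : ∀ {ℓ} → ExcludedMiddle ℓ) {G H : BaseGroup}
  (X : BaseSpace G) (Y : BaseSpace H) (point : BaseSpace.Carrier X)
  (f : BaseSpace.Carrier X → BaseSpace.Carrier Y)
  (reduction : ∀ x x′ → BaseSpace._∼_ X x x′ ⇔ BaseSpace._∼_ Y (f x) (f x′))
  (preimage-agrees : ∀ n → ∃ λ (V : Pred (BaseSpace.Carrier X) 0ℓ) → BaseSpace.IsOpen X V ×
    BaseSpace.Comeager X (λ x → (f x ∈ BaseSpace.B Y n → x ∈ V) × (x ∈ V → f x ∈ BaseSpace.B Y n)))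
  (preimage-comeager : ∀ {P : Pred (BaseSpace.Carrier Y) (Level.suc 0ℓ)} →
    BaseSpace.Comeager Y P → BaseSpace.Comeager X (λ x → f x ∈ P))
  where
  private
    module G = BaseGroup G
    module H = BaseGroup H
    module X = BaseSpace X
    module Y = BaseSpace Y
  open X using (_·_) renaming (_∼_ to _~_)
  open Y using () renaming (_·_ to _∗_; _∼_ to _≋_)

  f-agrees : X.Comeager (λ x → ∀ n → let V = proj₁ (preimage-agrees n) in
               (f x ∈ Y.B n → x ∈ V) × (x ∈ V → f x ∈ Y.B n))
  f-agrees = X.com-⋂ ℕ-enum λ n → proj₂ (proj₂ (preimage-agrees n))

  open X.Comeager f-agrees renaming (O to C; O-open to C-open; O-dense to C-dense; O⊆ to C⊆)

  -- On `C` the preimage of each basic set coincides with an open set: the usual argument for Baire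
  -- measurable maps.
  f-cont : ContinuousOn X.polish Y.polish (⋂ ℕ C) f
  f-cont {n = n} x∈ fx∈ =
    let (m , x∈m , m⊆) = proj₁ (proj₂ (preimage-agrees n)) (proj₁ (C⊆ x∈ n) fx∈)
    in m , x∈m , λ z∈m z∈ → proj₂ (C⊆ z∈ n) (m⊆ z∈m)

  C-comeager : X.Comeager (⋂ ℕ C)
  C-comeager = X.comeager C C-open C-dense id

  f-∼ : ∀ {x x′} → x ~ x′ → f x ≋ f x′
  f-∼ = Equivalence.to (reduction _ _)

  ∼-f : ∀ {x x′} → f x ≋ f x′ → x ~ x′
  ∼-f = Equivalence.from (reduction _ _)

  module F = Embedding em X Y C C-open f f-cont (λ g _ _ → f-∼ (g , X.refl))
  module S = Section em X.polish Y C C-open f f-cont point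
  open S using (ψ; D; D-open; Saturation; ψ-selected; ψ-cont; saturation⇒D)

  ψ-orbit : ∀ {y} → y ∈ ⋂ ℕ D → f (ψ y) ≋ y
  ψ-orbit {y} y∈ = S.Selected.orbit (ψ-selected {y} y∈)

  -- On the domain of `ψ`, f ∘ ψ is the identity up to orbits, and f reflects orbit equivalence.
  ψ-hom : ∀ {y} h → y ∈ ⋂ ℕ D → h ∗ y ∈ ⋂ ℕ D → ψ y ~ ψ (h ∗ y)
  ψ-hom {y} h y∈ hy∈ =
    ∼-f (Y.∼-trans (ψ-orbit {y} y∈) (Y.∼-trans (h , Y.refl) (Y.∼-sym (ψ-orbit {h ∗ y} hy∈))))

  module Ψ = Embedding em Y X D D-open ψ ψ-cont ψ-hom

  -- Membership in the domain of `ψ` is conditional, because generic points of Y may lie off the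
  -- saturation. For x in `C`, the translates of f x satisfy the premise.
  Z Z≈ Z⁺ : Pred Y.Carrier (Level.suc 0ℓ)
  Z y = y ∈ Ψ.Good × (y ∈ Saturation → y ∈ ⋂ ℕ D)
  Z≈ y = ∀ {y′} → y Y.≈ y′ → y′ ∈ Z
  Z⁺ y = H.Comeager (λ h → h ∗ y ∈ Z≈)

  K : Pred X.Carrier (Level.suc 0ℓ)
  K x = x ∈ ⋂ ℕ C × x ∈ F.Good × f x ∈ Z⁺

  K≈ : X.Comeager (λ x → ∀ {x′} → x X.≈ x′ → x′ ∈ K)
  K≈ = X.com-≈ (X.com-∩ C-comeager (X.com-∩ F.good
    (preimage-comeager (Y.com-orbit (Y.com-≈ (Y.com-∩ Ψ.good saturation⇒D))))))

  orbitwise-K : X.X×G.Comeager (λ (x , g) → ∀ {x′} → g · x X.≈ x′ → x′ ∈ K)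
  orbitwise-K = X.com-action K≈

  open Product X.base G.base using (kernel; kernel-open; kernel-dense; kernel-sections)

  X₀-open : ℕ → Pred X.Carrier 0ℓ
  X₀-open k = kernel orbitwise-K (proj₁ (unpair k)) (proj₂ (unpair k))

  -- A Vaught transform: x belongs to it when, for each open set O witnessing `K≈`, the g with g · x
  -- ∈ O are dense in G. This is a Gδ condition, and it is invariant because right translations of G
  -- preserve density.
  X₀ : Pred X.Carrier 0ℓ
  X₀ = ⋂ ℕ X₀-open

  X₀-open-open : ∀ k → X.IsOpen (X₀-open k)
  X₀-open-open k = kernel-open orbitwise-K (proj₁ (unpair k)) (proj₂ (unpair k))

  X₀-comeager : X.Comeager X₀
  X₀-comeager = X.comeager X₀-open X₀-open-open
    (λ k → kernel-dense orbitwise-K (proj₁ (unpair k)) (proj₂ (unpair k))) id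

  X₀-kernel : ∀ {x} → x ∈ X₀ → ∀ n m → x ∈ kernel orbitwise-K n m
  X₀-kernel {x} x∈ n m = let (k , eq) = pair n m in
    subst (λ (n , m) → x ∈ kernel orbitwise-K n m) eq (x∈ k)

  X₀-invariant : ∀ {x y} → x ~ y → x ∈ X₀ → y ∈ X₀
  X₀-invariant {x} {y} (g , gx≈y) x∈ k =
    let
      n = proj₁ (unpair k)
      (q , q∈) = G.nonempty (proj₂ (unpair k))
      (a , _ , a⊆) = G.∙ʳ-open (g G.⁻¹) (G.B-open _) (G.B-resp _ (G.sym (G.[gh]h⁻¹≈g q g)) q∈)
      (p , p∈a , px∈) = X₀-kernel x∈ n a
    in p G.∙ g G.⁻¹ , a⊆ p∈a ,

       X.open-resp (X.Comeager.O-open K≈ n)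
         (X.trans (X.sym (X.·-cong G.refl (X.g⁻¹gx≈x g x)))
           (X.trans (X.·-cong G.refl (X.·-cong G.refl gx≈y)) (X.sym (X.·-assoc p (g G.⁻¹) y)))) px∈

  orbit-typical : ∀ {x} → x ∈ X₀ → G.Comeager (λ g → ∀ {x′} → g · x X.≈ x′ → x′ ∈ K)
  orbit-typical x∈ = kernel-sections orbitwise-K (X₀-kernel x∈)

  meets-K : ∀ {x} → x ∈ X₀ → ∃ λ g → g · x ∈ K
  meets-K x∈ = let (g , _ , g∈) = G.baire-open (orbit-typical x∈) G.U-open (G.ε , _)
               in g , g∈ X.refl

  -- Representatives of the orbit of x that meet the hypotheses of `F.embeds`; `Below` does the same
  -- for the orbit of f x and `Ψ.embeds`.
  Above : X.Carrier → Pred X.Carrier (Level.suc 0ℓ)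
  Above x z = z ~ x × z ∈ F.Good × z ∈ ⋂ ℕ C × G.Comeager (λ g → g · z ∈ ⋂ ℕ C)

  Below : X.Carrier → Pred Y.Carrier (Level.suc 0ℓ)
  Below x y = ψ y ~ x × y ≋ f x × y ∈ Ψ.Good × y ∈ ⋂ ℕ D × H.Comeager (λ h → h ∗ y ∈ ⋂ ℕ D)

  above : ∀ {x} → x ∈ X₀ → ∃ (Above x)
  above {x} x∈ =
    let (g , z∈C , z-good , _) = meets-K x∈ in
    g · x , X.∼-sym (g , X.refl) , z-good , z∈C ,
    G.com-mono (λ {k} typ → proj₁ (typ (X.·-assoc k g x))) (G.com-∙ʳ g (orbit-typical x∈))

  below : ∀ {x} → x ∈ X₀ → ∃ (Below x)
  below {x} x∈ =
    let
      (g , z∈C , _ , fz∈Z⁺) = meets-K x∈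
      z∼x = X.∼-sym (g , X.refl)
      (h , _ , hfz∈Z) = H.baire-open fz∈Z⁺ H.U-open (H.ε , _)
      (y-good , y-sat) = hfz∈Z Y.refl
      y∈D = y-sat (h , g · x , z∈C , Y.refl)
      y∼fz = Y.∼-sym (h , Y.refl)
    in h ∗ f (g · x) , X.∼-trans (∼-f (Y.∼-trans (ψ-orbit {h ∗ f (g · x)} y∈D) y∼fz)) z∼x ,
       Y.∼-trans y∼fz (f-∼ z∼x) , y-good , y∈D ,
       H.com-mono (λ {k} typ → let k∗y≈ = Y.·-assoc k h (f (g · x)) in
            proj₂ (typ k∗y≈) (k H.∙ h , g · x , z∈C , k∗y≈))
          (H.com-∙ʳ h fz∈Z⁺)

  f-embeds : ∀ {x x′ z z′} → Above x z → Above x′ z′ → X.Embedsᴮ z z′ → Y.Embedsᴮ (f z) (f z′)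
  f-embeds (_ , z-good , z∈C , z-orbit) (_ , z′-good , z′∈C , z′-orbit) =
    F.embeds z-good z∈C z-orbit z′-good z′∈C z′-orbit

  ψ-embeds : ∀ {x x′ y y′} → Below x y → Below x′ y′ → Y.Embedsᴮ y y′ → X.Embedsᴮ (ψ y) (ψ y′)
  ψ-embeds (_ , _ , y-good , y∈D , y-orbit) (_ , _ , y′-good , y′∈D , y′-orbit) =
    Ψ.embeds y-good y∈D y-orbit y′-good y′∈D y′-orbit

  Y₀ : Pred Y.Carrier 0ℓ
  Y₀ y = ∃ λ x → x ∈ X₀ × f x ≋ y

  C∩X₀ : ℕ → Pred X.Carrier 0ℓ
  C∩X₀ n = C n ∩ X₀-open n

  f-cont₀ : ContinuousOn X.polish Y.polish (⋂ ℕ C∩X₀) f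
  f-cont₀ x∈ fx∈ =
    let (m , x∈m , m⊆) = f-cont (λ n → proj₁ (x∈ n)) fx∈
    in m , x∈m , λ z∈m z∈ → m⊆ z∈m (λ n → proj₁ (z∈ n))

  module S₀ = Section em X.polish Y C∩X₀ (λ n → X.∩-open (C-open n) (X₀-open-open n))
                      f f-cont₀ point

  -- f need not be continuous on `X₀`, but every orbit in `X₀` meets `C`. So `Y₀` is also the
  -- saturation of f (C ∩ X₀), to which `Section` applies; this is how it gets the Baire property.
  Y₀⊆Saturation : Y₀ ⊆ S₀.Saturation
  Y₀⊆Saturation (x , x∈ , fx∼y) =
    let (g , gx∈C , _) = meets-K x∈
        gx∈X₀ = X₀-invariant (g , X.refl) x∈
        (h , hfgx≈y) = Y.∼-trans (f-∼ (X.∼-sym (g , X.refl))) fx∼y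
    in h , g · x , (λ n → gx∈C n , gx∈X₀ n) , hfgx≈y

  Saturation⊆Y₀ : S₀.Saturation ⊆ Y₀
  Saturation⊆Y₀ (h , x , x∈ , hfx≈y) = x , (λ n → proj₂ (x∈ n)) , h , hfx≈y

  Y₀-agrees : Y.Comeager (λ y → (y ∈ Y₀ → y ∈ S₀.D 0) × (y ∈ S₀.D 0 → y ∈ Y₀))
  Y₀-agrees = Y.com-mono
    (λ (sat , hull) → (λ y∈Y₀ → sat (Y₀⊆Saturation y∈Y₀) 0) ,
                      (λ y∈D₀ → Saturation⊆Y₀ (S₀.D⊆Saturation (hull y∈D₀))))
    (Y.com-∩ S₀.saturation⇒D S₀.hull⇒D)

-- From topological and metric notions to bases, and back

module Meagerness (em : ∀ {ℓ} → ExcludedMiddle ℓ) (T : TopologicalSpace) (isPolish : IsPolish T)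
                  (point : TopologicalSpace.Carrier T) where
  open Choice em
  open TopologicalSpace T using (Carrier; Open)
  private bT = polish-base T isPolish point
  open PolishBase bT

  meager⇒comeager : ∀ {A} → Meager T A → Comeager (λ x → x ∉ A)
  meager⇒comeager (F , F-nowhere , A⊆ , _) = com-mono {P = λ x → ∀ n → x ∈ ext (F n)}
    (λ ext-F x∈A → let (n , x∈F) = A⊆ x∈A ; (m , x∈m , m∩F) = ext-F n in m∩F x∈m x∈F)
    (com-⋂ ℕ-enum λ n → com-open (ext-open (F n)) (ext-dense n))
    where
    ext-dense : ∀ n → IsDense (ext (F n))
    ext-dense n m = by-contradiction λ none →
      let (x , x∈m) = nonempty m in
      F-nowhere n x (B m , base⇒open T isPolish point (B-open m) , x∈m , λ {y} y∈m V oV y∈V →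
        by-contradiction λ V∩F →
          let (k , y∈k , k⊆V) = open⇒base T isPolish point oV y∈V
          in none (y , y∈m , k , y∈k , λ {z} z∈k z∈F → V∩F (z , k⊆V z∈k , z∈F)))

  comeager⇒meager : ∀ {A} → Comeager (λ x → x ∉ A) → Meager T A
  comeager⇒meager {A} (comeager O O-open O-dense O⊆) =
    -- `Meager` asks for equality with the union, so the complements of the `O n` are cut down to
    -- `A`.
    (λ n x → x ∈ A × x ∉ O n) , nowhere ,
    (λ {x} x∈A → by-contradiction λ none →
      O⊆ (λ n → by-contradiction λ x∉O → none (n , x∈A , x∉O)) x∈A) ,
    (λ (n , x∈A , _) → x∈A)
    where
    nowhere : ∀ n → NowhereDense T (λ x → x ∈ A × x ∉ O n)
    nowhere n x (V , oV , x∈V , V⊆cl) =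
      let (m , _ , m⊆V) = open⇒base T isPolish point oV x∈V
          (z , z∈m , z∈O) = O-dense n m
          (w , w∈O , _ , w∉O) = V⊆cl (m⊆V z∈m) (O n) (base⇒open T isPolish point (O-open n)) z∈O
      in w∉O w∈O

  Agrees : Pred Carrier 0ℓ → Pred Carrier 0ℓ → Set₁
  Agrees A V = Comeager (λ x → (x ∈ A → x ∈ V) × (x ∈ V → x ∈ A))

  baire⇒agrees : ∀ {A} → BaireMeasurable T A → ∃ λ V → IsOpen V × Agrees A V
  baire⇒agrees (V , oV , meager) = V , open⇒base T isPolish point oV , com-mono
    (λ x∉ → (λ x∈A → by-contradiction λ x∉V → x∉ (inj₁ (x∈A , x∉V))) ,
            (λ x∈V → by-contradiction λ x∉A → x∉ (inj₂ (x∈V , x∉A))))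
    (meager⇒comeager meager)

  agrees⇒baire : ∀ {A V} → IsOpen V → Agrees A V → BaireMeasurable T A
  agrees⇒baire {V = V} oV agrees = V , base⇒open T isPolish point oV , comeager⇒meager (com-mono
    (λ (to , from) → [ (λ (x∈A , x∉V) → x∉V (to x∈A)) , (λ (x∈V , x∉A) → x∉A (from x∈V)) ]′)
    agrees)

baseGroup : PolishGroup → BaseGroup
baseGroup G = record
  { group = group
  ; polish = polish-base space isPolish ε
  ; ∙-cont = λ {n} {g} {h} gh∈ →
      let (_ , _ , oV , oW , g∈ , h∈ , VW⊆) = proj₂ (∙-continuous (to-open (P.B-open n))) g h gh∈
          (a , g∈a , a⊆) = to-base oV g∈
          (b , h∈b , b⊆) = to-base oW h∈
      in a , b , g∈a , h∈b , λ g′∈ h′∈ → VW⊆ (a⊆ g′∈ , b⊆ h′∈)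
  ; ⁻¹-cont = λ {n} g∈ → to-base (⁻¹-continuous (to-open (P.B-open n))) g∈
  }
  where
  open PolishGroup G
  module P = PolishBase (polish-base space isPolish ε)
  to-open = λ {V} → base⇒open space isPolish ε {V}
  to-base = λ {V} → open⇒base space isPolish ε {V}

baseSpace : ∀ {G} (X : PolishGSpace G) → PolishGSpace.Carrier X → BaseSpace (baseGroup G)
baseSpace {G} X point = record
  { setoid = setoid
  ; polish = polish-base space isPolish point
  ; _·_ = _·_
  ; ·-cong = ·-cong
  ; ·-identity = ·-identity
  ; ·-assoc = ·-assoc
  ; ·-cont = λ {n} {g} {x} gx∈ →
      let (_ , _ , oV , oW , g∈ , x∈ , VW⊆) =
            proj₂ (·-continuous (base⇒open space isPolish point (P.B-open n))) g x gx∈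
          (a , g∈a , a⊆) = open⇒base G.space G.isPolish G.ε oV g∈
          (b , x∈b , b⊆) = open⇒base space isPolish point oW x∈
      in a , b , g∈a , x∈b , λ g′∈ x′∈ → VW⊆ (a⊆ g′∈ , b⊆ x′∈)
  }
  where
  module G = PolishGroup G
  open PolishGSpace X
  module P = PolishBase (polish-base space isPolish point)

module _ (G : PolishGroup) where
  open PolishGroup G
  private module B = BaseGroup (baseGroup G)

  -- Right translation by (s i)⁻¹ turns d (s i) (s j) into the distance from `ε` to s j ∙ (s i)⁻¹.
  rightCauchy⇒base : ∀ {s} → RightCauchy s → B.RightCauchyᴮ s
  rightCauchy⇒base {s} (ρ , compat , inv , cauchy) {m} ε∈m =
    let
      (r , 0<r , ball⊆) = Equivalence.to (compat {B.B m})
        (base⇒open space isPolish ε (B.B-open m)) ε∈m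
      (N , close) = cauchy r 0<r
    in N , λ {i} {j} N≤i N≤j → ball⊆
      (≃ᴿ-<ᴿ-trans (d ε (s j ∙ s i ⁻¹)) (d (s i ∙ s i ⁻¹) (s j ∙ s i ⁻¹)) r
        (d-cong ρ (sym (inverseʳ (s i))) refl)
        (≃ᴿ-<ᴿ-trans (d (s i ∙ s i ⁻¹) (s j ∙ s i ⁻¹)) (d (s i) (s j)) r
          (inv (s i) (s j) (s i ⁻¹)) (close i j N≤i N≤j)))
    where
    open Metric using (d-cong)
    d = Metric.d ρ

  base⇒rightCauchy : (∀ {ℓ} → ExcludedMiddle ℓ) → ∀ {s} → B.RightCauchyᴮ s → RightCauchy s
  base⇒rightCauchy em s-cauchy =
    BK.metric ,
    (λ {V} → mk⇔ (λ oV {x} → BK.open⇒metric {V} (open⇒base space isPolish ε oV) {x})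
                 (λ mV → base⇒open space isPolish ε (BK.metric⇒open {V} mV))) ,
    BK.dist-invariant , BK.cauchy s-cauchy
    where module BK = BirkhoffKakutani em (baseGroup G)

module _ {G : PolishGroup} (X : PolishGSpace G) (point : PolishGSpace.Carrier X) where
  open PolishGSpace X
  private module B = BaseSpace (baseSpace X point)

  embeds⇒base : ∀ {x x′} → RightEmbeds x x′ → B.Embedsᴮ x x′
  embeds⇒base (s , cauchy , conv) = s , rightCauchy⇒base G cauchy , λ {m} x∈m →
    let (N , eventually) = conv (B.B m) (base⇒open space isPolish point (B.B-open m)) x∈m
    in N , λ {n} → eventually n

  base⇒embeds : (∀ {ℓ} → ExcludedMiddle ℓ) → ∀ {x x′} → B.Embedsᴮ x x′ → RightEmbeds x x′
  base⇒embeds em (s , cauchy , conv) = s , base⇒rightCauchy G em cauchy , λ V oV x∈V →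
    let (m , x∈m , m⊆) = open⇒base space isPolish point oV x∈V
        (N , eventually) = conv x∈m
    in N , λ n N≤n → m⊆ (eventually N≤n)

-- A point of X is asked for because, over an empty X, the isomorphism would force `Y₀` to be empty
-- and hence meager.
theorem3 :
    (∀ {ℓ} → ExcludedMiddle ℓ) →
    (G H : PolishGroup) (X : PolishGSpace G) (Y : PolishGSpace H) →
    let module X = PolishGSpace X
        module Y = PolishGSpace Y
    in
    X.Carrier →
    (f : Func X.setoid Y.setoid) →
    IsStarReduction X.space Y.space X.OrbitEq Y.OrbitEq f →
    ∃ λ (X₀ : Pred X.Carrier 0ℓ) → ∃ λ (Y₀ : Pred Y.Carrier 0ℓ) →
      (X.Invariant X₀ × Dense X.space X₀ × IsGδ X.space X₀) ×
      (Y.Invariant Y₀ × ¬ Meager Y.space Y₀ × BaireMeasurable Y.space Y₀) ×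
      Σ (∀ x → x ∈ X₀ → Func.to f x ∈ Y₀) λ f[X₀]⊆Y₀ →
        IsDigraphIsomorphism (Becker X X₀) (Becker Y Y₀)
          (λ (x , x∈X₀) → Func.to f x , f[X₀]⊆Y₀ x x∈X₀)
theorem3 em G H X Y point f star =
  R.X₀ , R.Y₀ ,
  (R.X₀-invariant , X₀-dense , X₀-gδ) ,
  ((λ y∼y′ (x , x∈ , fx∼y) → x , x∈ , Y∼.trans fx∼y y∼y′) , Y₀-nonmeager ,
   MY.agrees⇒baire (R.S₀.D-open 0) R.Y₀-agrees) ,
  f[X₀]⊆Y₀ ,
  record
    { isBijection = record
      { isInjection = record
        { isCongruent = record
          { cong = R.f-∼
          ; isEquivalence₁ = Digraph.isEquivalence (Becker X R.X₀)
          ; isEquivalence₂ = Digraph.isEquivalence (Becker Y R.Y₀) }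
        ; injective = R.∼-f }
      ; surjective = λ (y , x , x∈ , fx∼y) → (x , x∈) , λ z∼x → Y∼.trans (R.f-∼ z∼x) fx∼y }
    ; arrows = λ (x , x∈) (x′ , x′∈) → mk⇔ (forward x∈ x′∈) (backward x∈ x′∈) }
  where
  module X = PolishGSpace X
  module Y = PolishGSpace Y
  module X∼ = IsEquivalence X.OrbitEq-isEquivalence
  module Y∼ = IsEquivalence Y.OrbitEq-isEquivalence
  open Func f using (to)
  open IsStarReduction star
  module MX = Meagerness em X.space X.isPolish point
  module MY = Meagerness em Y.space Y.isPolish (to point)
  Xᴮ = baseSpace X point
  Yᴮ = baseSpace Y (to point)
  module Xᴮ = BaseSpace Xᴮ
  module Yᴮ = BaseSpace Yᴮ
  open Choice em

  preimage-comeager : ∀ {P : Pred Y.Carrier 1ℓ} → Yᴮ.Comeager P → Xᴮ.Comeager (λ x → to x ∈ P)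
  preimage-comeager {P} cP = Xᴮ.com-mono
    (λ ¬¬P → by-contradiction λ ∉P → ¬¬P λ Pfx → ∉P (unsmall Pfx))
    -- `CategoryPreserving` speaks of small sets, so the complement of `P` is resized, and the
    -- double negation is removed on the way back.
    (MX.meager⇒comeager (categoryPreserving (λ y → ¬ Small (y ∈ P))
      (MY.comeager⇒meager (Yᴮ.com-mono (λ y∈ ¬y∈ → ¬y∈ (small y∈)) cP))))

  module R = StarReduction em Xᴮ Yᴮ point to reduction
    (λ n → MX.baire⇒agrees (baireMeasurable (Yᴮ.B n)
      (base⇒open Y.space Y.isPolish (to point) (Yᴮ.B-open n))))
    preimage-comeager

  X₀-dense : Dense X.space R.X₀
  X₀-dense x V oV x∈V =
    Xᴮ.baire-open R.X₀-comeager (open⇒base X.space X.isPolish point oV) (x , x∈V)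

  X₀-gδ : IsGδ X.space R.X₀
  X₀-gδ = R.X₀-open , (λ k → base⇒open X.space X.isPolish point (R.X₀-open-open k)) , id , id

  f[X₀]⊆Y₀ : ∀ x → x ∈ R.X₀ → to x ∈ R.Y₀
  f[X₀]⊆Y₀ x x∈ = x , x∈ , Y∼.refl

  -- The preimage of `Y₀` contains the comeager set `X₀`, and f pulls meager sets back to meager
  -- sets.
  Y₀-nonmeager : ¬ Meager Y.space R.Y₀
  Y₀-nonmeager meager =
    let (m , _) = Xᴮ.cover point
        (x , _ , x∉ , x∈) = Xᴮ.baire
          (Xᴮ.com-∩ (MX.meager⇒comeager (categoryPreserving R.Y₀ meager)) R.X₀-comeager) m
    in x∉ (f[X₀]⊆Y₀ x x∈)

  forward : ∀ {x x′} → x ∈ R.X₀ → x′ ∈ R.X₀ → X.RightEmbeds x x′ → Y.RightEmbeds (to x) (to x′)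
  forward x∈ x′∈ emb =
    let (z , z-above) = R.above x∈
        (z′ , z′-above) = R.above x′∈
        z∼x = proj₁ z-above
        z′∼x′ = proj₁ z′-above
    in RightEmbeds-resp Y (R.f-∼ z∼x) (Y∼.sym (R.f-∼ z′∼x′))
         (base⇒embeds Y (to point) em (R.f-embeds z-above z′-above
           (embeds⇒base X point (RightEmbeds-resp X (X∼.sym z∼x) z′∼x′ emb))))

  backward : ∀ {x x′} → x ∈ R.X₀ → x′ ∈ R.X₀ → Y.RightEmbeds (to x) (to x′) → X.RightEmbeds x x′
  backward x∈ x′∈ emb =
    let (y , y-below) = R.below x∈
        (y′ , y′-below) = R.below x′∈
        (ψy∼x , y∼fx , _) = y-below
        (ψy′∼x′ , y′∼fx′ , _) = y′-below
    in RightEmbeds-resp X ψy∼x (X∼.sym ψy′∼x′)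
         (base⇒embeds X point em (R.ψ-embeds y-below y′-below
           (embeds⇒base Y (to point) (RightEmbeds-resp Y (Y∼.sym y∼fx) y′∼fx′ emb))))
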